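{- Let $G$ be a finite simple 5-connected graph. Then $G$ contains a quasi 5-contractible edge.
   Context: All graphs are finite, simple and undirected. For an edge $e=xy$, $G/e$ denotes the graph obtained by deleting $e$, identifying $x$ and $y$, and replacing any resulting multiple edges by single edges. A cut of a connected graph $G$ is a set $T\subseteq V(G)$ with $G-T$ disconnected; a $k$-cut is a cut with $k$ vertices. A $k$-cut $T$ is nontrivial if the components of $G-T$ can be partitioned into two subgraphs $G_1,G_2$ with $|V(G_1)|\ge 2$ and $|V(G_2)|\ge 2$. A graph is quasi $k$-connected if it is $(k-1)$-connected and has no nontrivial $(k-1)$-cut (so every $k$-connected graph is quasi $k$-connected). An edge $e$ of a quasi $k$-connected graph $G$ is quasi $k$-contractible if $G/e$ is quasi $k$-connected. -}

module Defs where

open import Data.Nat using (ℕ; zero; suc; _<_; _≤_; _∸_)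
open import Data.Fin using (Fin; punchIn)
open import Data.Fin.Subset using (Subset; _∈_; _∉_; ∣_∣; ∁)
open import Data.Product using (Σ; _×_; ∃)
open import Data.Sum using (_⊎_)
open import Relation.Nullary using (¬_)
open import Relation.Binary.PropositionalEquality using (_≡_; _≢_)

record Graph (n : ℕ) : Set₁ where
  field
    Adj    : Fin n → Fin n → Set
    sym    : ∀ {u v} → Adj u v → Adj v u
    irrefl : ∀ {u} → ¬ Adj u u
open Graph public

data Reach {n} (G : Graph n) (S : Subset n) : Fin n → Fin n → Set where
  here : ∀ {x} → x ∈ S → Reach G S x x
  step : ∀ {x y z} → x ∈ S → Adj G x y → Reach G S y z → Reach G S x z

ConnectedWithout : ∀ {n} → Graph n → Subset n → Set
ConnectedWithout {n} G T =
  (∃ λ (v : Fin n) → v ∉ T) ×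
  (∀ u v → u ∉ T → v ∉ T → Reach G (∁ T) u v)

_IsConnected_ : ∀ {n} → Graph n → ℕ → Set
_IsConnected_ {n} G k = k < n × (∀ (T : Subset n) → ∣ T ∣ < k → ConnectedWithout G T)

NontrivialCut : ∀ {n} → Graph n → ℕ → Set
NontrivialCut {n} G k =
  Σ (Subset n) λ T → ∣ T ∣ ≡ k ×
  Σ (Subset n) λ A → Σ (Subset n) λ B →
    (∀ v → v ∉ T → v ∈ A ⊎ v ∈ B) ×
    (∀ v → v ∈ T → v ∉ A) ×
    (∀ v → v ∈ T → v ∉ B) ×
    (∀ v → v ∈ A → v ∉ B) ×
    (∀ u v → u ∈ A → v ∈ B → ¬ Adj G u v) ×
    2 ≤ ∣ A ∣ × 2 ≤ ∣ B ∣

QuasiConnected : ∀ {n} → Graph n → ℕ → Set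
QuasiConnected G k = (G IsConnected (k ∸ 1)) × ¬ NontrivialCut G (k ∸ 1)

-- Contraction G/xy (x ≠ y): vertex y is deleted, x represents the merged vertex.
-- Vertices of G/xy are Fin n, embedded in Fin (suc n) by punchIn y (skipping y).
contract : ∀ {n} → Graph (suc n) → (x y : Fin (suc n)) → x ≢ y → Graph n
contract {n} G x y x≢y = record
  { Adj = A
  ; sym = λ { (ne , inj₁ a) → (λ e → ne (≡sym e)) , inj₁ (Graph.sym G a)
            ; (ne , inj₂ (inj₁ (p , a))) → (λ e → ne (≡sym e)) , inj₂ (inj₂ (p , Graph.sym G a))
            ; (ne , inj₂ (inj₂ (p , a))) → (λ e → ne (≡sym e)) , inj₂ (inj₁ (p , Graph.sym G a)) }
  ; irrefl = λ { (ne , _) → ne refl }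
  }
  where
  open import Data.Product using (_,_)
  open import Data.Sum using (inj₁; inj₂)
  open import Relation.Binary.PropositionalEquality using (refl) renaming (sym to ≡sym)
  A : Fin n → Fin n → Set
  A u v = u ≢ v ×
    ( Adj G (punchIn y u) (punchIn y v)
    ⊎ (punchIn y u ≡ x × Adj G y (punchIn y v))
    ⊎ (punchIn y v ≡ x × Adj G (punchIn y u) y))

_/_ : ∀ {n} (G : Graph (suc n)) → (Σ (Fin (suc n)) λ x → Σ (Fin (suc n)) λ y → Adj G x y) → Graph n
G / (x Data.Product., y Data.Product., e) = contract G x y (λ eq → Graph.irrefl G (Relation.Binary.PropositionalEquality.subst (λ z → Adj G z y) eq e))
  where import Data.Product
        import Relation.Binary.PropositionalEquality

{-# OPTIONS --safe #-}
module Submission where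

-- An edge xy of a 5-connected graph is quasi 5-contractible unless x and y lie in the separator of a
-- good separation: five vertices in the separator, at least two on each side.  Suppose this happens for
-- every edge and choose a side A of least size, with separator T.
--
-- Submodularity against the separations through the edges at A leaves |A| = 2 after a short
-- combinatorial argument.  Let A = {a, b}.  Good separations containing a but not b in the separator
-- must exist, and vice versa: otherwise every t in T lies in a separator {a, b, t, ..} that halves
-- T ∖ {t}, and the five resulting pairings are incompatible.  Hence there are private neighbours x of a
-- and y of b in T, and separators S containing {a, b, x} and R containing {a, b, y}.  Crossing S with a
-- separation through a alone shows that one of its sides is {x, s} with s in S, where the
-- neighbourhood of s is known; symmetrically there is r in R next to y.  Crossing S with R forces r = s
-- and yields a further vertex of S that is adjacent to s, which is impossible.

open import Defs hiding (sym; irrefl)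
open import Data.Bool using (Bool; true; false; not; _∧_; _∨_; if_then_else_)
import Data.Bool as Bool
open import Data.Empty using (⊥; ⊥-elim)
open import Data.Fin using (Fin; zero; suc; punchIn; punchOut)
open import Data.Fin.Patterns
import Data.Fin as Fin
import Data.Fin.Properties as Fin
open import Data.Fin.Subset using (Subset; ∁; ∣_∣; inside; outside; _∈_; _∉_)
open import Data.Fin.Subset.Properties using (_∈?_; anySubset?; x∈∁p⇒x∉p; x∉p⇒x∈∁p; drop-there)
open import Data.List using (List; []; _∷_; _++_; concatMap; length)
import Data.List.Membership.DecPropositional as DecMembership
import Data.List.Membership.Propositional as List
open import Data.List.Relation.Unary.All using (All; []; _∷_)
import Data.List.Relation.Unary.All as All
import Data.List.Relation.Unary.All.Properties as All
open import Data.List.Relation.Unary.AllPairs using ([]; _∷_)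
open import Data.List.Relation.Unary.Any using (here; there)
open import Data.List.Relation.Unary.Unique.Propositional using (Unique)
open import Data.Nat hiding (_/_)
open import Data.Nat.Induction using (<-rec)
open import Data.Nat.Properties
open import Data.Nat.Tactic.RingSolver using (solve-∀)
open import Data.Product using (_×_; _,_; proj₁; proj₂; ∃; ∃₂; Σ; swap)
open import Data.Product.Properties using (≡-dec)
open import Data.Sum using (_⊎_; inj₁; inj₂; [_,_]′)
import Data.Sum as Sum
open import Data.Unit using (tt)
open import Data.Vec using (Vec; []; _∷_; zipWith; map; lookup; tabulate; there)
open import Data.Vec.Properties using (lookup∘tabulate; lookup⇒[]=; []=⇒lookup)
open import Function using (_∘_; case_of_; id)
open import Level using (0ℓ)
open import Relation.Binary.Definitions using (tri<; tri≈; tri>)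
open import Relation.Binary.PropositionalEquality
open import Relation.Nullary using (¬_; Dec; yes; no; does)
open import Relation.Nullary.Decidable using (_×-dec_; _⊎-dec_; _→-dec_; ¬?; decidable-stable; map′; dec-true)
open import Relation.Unary using (Pred; Decidable)

-- `Adj` is an arbitrary family of types, so adjacency cannot be decided, yet the argument counts
-- neighbours and searches for separations. It therefore takes place in a decidable spanning
-- subgraph that is still 5-connected. Nothing is lost: a nontrivial 4-cut of `G / e` pulls back to
-- a good separation of the subgraph, so an edge of the subgraph whose ends share no separator there
-- can be contracted in `G`.
--
-- Two crossing separations divide the vertices into nine cells, and the boundaries of opposite
-- corners together have as many vertices as the two separators, ten. Hence every counting step is a
-- linear statement about nine numbers, given that a nonempty corner has a boundary of at least 5.
-- Two refinements of this bound drive the proof. Vertices common to both separators without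
-- neighbours in a corner may be left out of its boundary, which raises the bound to 6 for `a` alone
-- and to 7 for `a` and `b`. A corner with one vertex and a boundary of five is, by the minimum
-- degree, joined to its whole boundary; most of the adjacencies arise in this way.

-- Linear arithmetic over the natural numbers

module LinearArithmetic where

  -- The last entry of a linear form is its constant term.
  eval : ∀ {n} → Vec ℕ (suc n) → Vec ℕ n → ℕ
  eval (c ∷ [])         []      = c
  eval (c ∷ cs@(_ ∷ _)) (x ∷ ρ) = c * x + eval cs ρ

  Ineq : ℕ → Set
  Ineq n = Vec ℕ (suc n) × Vec ℕ (suc n)

  Holds : ∀ {n} → Vec ℕ n → Ineq n → Set
  Holds ρ (l , r) = eval l ρ ≤ eval r ρ

  _+ᵛ_ : ∀ {n} → Vec ℕ n → Vec ℕ n → Vec ℕ n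
  _+ᵛ_ = zipWith _+_

  _*ᵛ_ : ∀ {n} → ℕ → Vec ℕ n → Vec ℕ n
  k *ᵛ v = map (k *_) v

  eval-+ : ∀ {n} (u v : Vec ℕ (suc n)) ρ → eval (u +ᵛ v) ρ ≡ eval u ρ + eval v ρ
  eval-+ (a ∷ [])         (b ∷ [])         []      = refl
  eval-+ (a ∷ as@(_ ∷ _)) (b ∷ bs@(_ ∷ _)) (x ∷ ρ) =
    trans (cong ((a + b) * x +_) (eval-+ as bs ρ)) (shuffle a b x (eval as ρ) (eval bs ρ))
    where
    shuffle : ∀ a b x s t → (a + b) * x + (s + t) ≡ (a * x + s) + (b * x + t)
    shuffle = solve-∀

  eval-* : ∀ {n} k (v : Vec ℕ (suc n)) ρ → eval (k *ᵛ v) ρ ≡ k * eval v ρ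
  eval-* k (a ∷ [])         []      = refl
  eval-* k (a ∷ as@(_ ∷ _)) (x ∷ ρ) =
    trans (cong (k * a * x +_) (eval-* k as ρ)) (shuffle k a x (eval as ρ))
    where
    shuffle : ∀ k a x s → k * a * x + k * s ≡ k * (a * x + s)
    shuffle = solve-∀

  +-∸-swap : ∀ {n} (u v : Vec ℕ n) → u +ᵛ zipWith _∸_ v u ≡ v +ᵛ zipWith _∸_ u v
  +-∸-swap []      []      = refl
  +-∸-swap (a ∷ u) (b ∷ v) =
    cong₂ _∷_ (trans (sym (m⊔n≡m+n∸m a b)) (trans (⊔-comm a b) (m⊔n≡m+n∸m b a))) (+-∸-swap u v)
    where
    m⊔n≡m+n∸m : ∀ m n → m ⊔ n ≡ m + (n ∸ m)
    m⊔n≡m+n∸m m n with ≤-total m n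
    ... | inj₁ m≤n = trans (m≤n⇒m⊔n≡n m≤n) (sym (m+[n∸m]≡n m≤n))
    ... | inj₂ n≤m = trans (m≥n⇒m⊔n≡m n≤m) (sym (trans (cong (m +_) (m≤n⇒m∸n≡0 n≤m)) (+-identityʳ m)))

  -- Only an inequality with the eliminated variable on one side takes part in `resolve`;
  -- subtracting the common part brings it into this form.
  cancel : ∀ {n} → Ineq n → Ineq n
  cancel (l , r) = zipWith _∸_ l r , zipWith _∸_ r l

  cancel-sound : ∀ {n} {ρ : Vec ℕ n} i → Holds ρ i → Holds ρ (cancel i)
  cancel-sound {ρ = ρ} (l , r) h = +-cancelˡ-≤ (eval r ρ) _ _ (begin
    eval r ρ + eval (zipWith _∸_ l r) ρ ≡⟨ eval-+ r _ ρ ⟨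
    eval (r +ᵛ zipWith _∸_ l r) ρ       ≡⟨ cong (λ w → eval w ρ) (+-∸-swap r l) ⟩
    eval (l +ᵛ zipWith _∸_ r l) ρ       ≡⟨ eval-+ l _ ρ ⟩
    eval l ρ + eval (zipWith _∸_ r l) ρ ≤⟨ +-monoˡ-≤ _ h ⟩
    eval r ρ + eval (zipWith _∸_ r l) ρ ∎)
    where open ≤-Reasoning

  isZero : ∀ {n} → Vec ℕ n → Bool
  isZero []          = true
  isZero (zero ∷ v)  = isZero v
  isZero (suc _ ∷ v) = false

  -- A zero left-hand side makes the inequality trivial, since all values are natural numbers.
  prune : ∀ {n} → Ineq n → List (Ineq n)
  prune (l , r) = if isZero l then [] else (l , r) ∷ []

  prune-sound : ∀ {n} {ρ : Vec ℕ n} i → Holds ρ i → All (Holds ρ) (prune i)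
  prune-sound (l , r) h with isZero l
  ... | true  = []
  ... | false = h ∷ []

  keep : ∀ {n} → Ineq n → List (Ineq n)
  keep i = prune (cancel i)

  keep-sound : ∀ {n} {ρ : Vec ℕ n} i → Holds ρ i → All (Holds ρ) (keep i)
  keep-sound {ρ = ρ} i h = prune-sound {ρ = ρ} (cancel i) (cancel-sound i h)

  -- Variables range over ℕ, so the eliminated one may be dropped from a left-hand side.
  weaken : ∀ {n} → Ineq (suc n) → List (Ineq n)
  weaken (_ ∷ l , zero ∷ r)  = keep (l , r)
  weaken (_ ∷ l , suc _ ∷ r) = []

  weaken-sound : ∀ {n} {ρ : Vec ℕ n} {x} i → Holds (x ∷ ρ) i → All (Holds ρ) (weaken i)
  weaken-sound {ρ = ρ} (a ∷ l@(_ ∷ _) , zero ∷ r@(_ ∷ _)) h =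
    keep-sound {ρ = ρ} (l , r) (m+n≤o⇒n≤o _ h)
  weaken-sound (_ ∷ l , suc _ ∷ r) h = []

  resolve : ∀ {n} → Ineq (suc n) → Ineq (suc n) → List (Ineq n)
  resolve (suc a ∷ l , zero ∷ r) (zero ∷ l′ , suc b ∷ r′) =
    keep ((suc b *ᵛ l) +ᵛ (suc a *ᵛ l′) , (suc b *ᵛ r) +ᵛ (suc a *ᵛ r′))
  resolve _ _ = []

  resolve-sound : ∀ {n} {ρ : Vec ℕ n} {x} i j → Holds (x ∷ ρ) i → Holds (x ∷ ρ) j →
                  All (Holds ρ) (resolve i j)
  resolve-sound {ρ = ρ} {x} (suc a ∷ l@(_ ∷ _) , zero ∷ r@(_ ∷ _)) (zero ∷ l′@(_ ∷ _) , suc b ∷ r′@(_ ∷ _)) h h′ =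
    keep-sound {ρ = ρ} ((suc b *ᵛ l) +ᵛ (suc a *ᵛ l′) , (suc b *ᵛ r) +ᵛ (suc a *ᵛ r′)) (begin
      eval ((suc b *ᵛ l) +ᵛ (suc a *ᵛ l′)) ρ  ≡⟨ expand l l′ ⟩
      suc b * eval l ρ + suc a * eval l′ ρ    ≤⟨ +-cancelˡ-≤ (suc a * (suc b * x)) _ _ (begin
        suc a * (suc b * x) + (suc b * eval l ρ + suc a * eval l′ ρ) ≡⟨ shuffle (suc a) (suc b) x (eval l ρ) (eval l′ ρ) ⟩
        suc b * (suc a * x + eval l ρ) + suc a * eval l′ ρ           ≤⟨ +-mono-≤ (*-monoʳ-≤ (suc b) h) (*-monoʳ-≤ (suc a) h′) ⟩
        suc b * eval r ρ + suc a * (suc b * x + eval r′ ρ)           ≡⟨ shuffle′ (suc a) (suc b) x (eval r ρ) (eval r′ ρ) ⟩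
        suc a * (suc b * x) + (suc b * eval r ρ + suc a * eval r′ ρ) ∎) ⟩
      suc b * eval r ρ + suc a * eval r′ ρ    ≡⟨ expand r r′ ⟨
      eval ((suc b *ᵛ r) +ᵛ (suc a *ᵛ r′)) ρ  ∎)
    where
    open ≤-Reasoning
    expand : ∀ u v → eval ((suc b *ᵛ u) +ᵛ (suc a *ᵛ v)) ρ ≡ suc b * eval u ρ + suc a * eval v ρ
    expand u v = trans (eval-+ (suc b *ᵛ u) (suc a *ᵛ v) ρ) (cong₂ _+_ (eval-* (suc b) u ρ) (eval-* (suc a) v ρ))
    shuffle : ∀ a b x s t → a * (b * x) + (b * s + a * t) ≡ b * (a * x + s) + a * t
    shuffle = solve-∀
    shuffle′ : ∀ a b x s t → b * s + a * (b * x + t) ≡ a * (b * x) + (b * s + a * t)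
    shuffle′ = solve-∀
  resolve-sound (zero ∷ _ , _ ∷ _) (_ ∷ _ , _ ∷ _) _ _ = []
  resolve-sound (suc _ ∷ _ , suc _ ∷ _) (_ ∷ _ , _ ∷ _) _ _ = []
  resolve-sound (suc _ ∷ _ , zero ∷ _) (suc _ ∷ _ , _ ∷ _) _ _ = []
  resolve-sound (suc _ ∷ _ , zero ∷ _) (zero ∷ _ , zero ∷ _) _ _ = []

  eliminate : ∀ {n} → List (Ineq (suc n)) → List (Ineq n)
  eliminate is = concatMap weaken is ++ concatMap (λ i → concatMap (resolve i) is) is

  concatMap⁺ : ∀ {A B : Set} {P : A → Set} {Q : B → Set} (f : A → List B) →
               (∀ x → P x → All Q (f x)) → ∀ {xs} → All P xs → All Q (concatMap f xs)
  concatMap⁺ f g []       = []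
  concatMap⁺ f g (p ∷ ps) = All.++⁺ (g _ p) (concatMap⁺ f g ps)

  -- Fourier–Motzkin elimination
  infeasible : ∀ {n} → List (Ineq n) → Bool
  infeasible {zero}  []                         = false
  infeasible {zero}  ((l ∷ [] , r ∷ []) ∷ is)   = (r <ᵇ l) ∨ infeasible is
  infeasible {suc n} is                         = infeasible (eliminate is)

  infeasible-sound : ∀ {n} (ρ : Vec ℕ n) is → infeasible is ≡ true → ¬ All (Holds ρ) is
  infeasible-sound []      ((l ∷ [] , r ∷ []) ∷ is) eq (h ∷ hs) with r <ᵇ l in lt
  ... | true  = ≤⇒≯ h (<ᵇ⇒< r l (subst Bool.T (sym lt) _))
  ... | false = infeasible-sound [] is eq hs
  infeasible-sound (x ∷ ρ) is eq hs = infeasible-sound ρ (eliminate is) eq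
    (All.++⁺ (concatMap⁺ weaken weaken-sound hs)
             (concatMap⁺ _ (λ i h → concatMap⁺ (resolve i) (λ j → resolve-sound i j h) hs) hs))

  infixl 7 _⊕_
  infix  6 _≼_ _≐_
  infixr 5 _∧′_
  infixr 4 _∨′_
  infixr 3 _⇒_

  data Term (n : ℕ) : Set where
    var : Fin n → Term n
    con : ℕ → Term n
    _⊕_ : Term n → Term n → Term n

  data Formula (n : ℕ) : Set where
    _≼_ _≐_       : Term n → Term n → Formula n
    _∧′_ _∨′_ _⇒_ : Formula n → Formula n → Formula n

  value : ∀ {n} → Vec ℕ n → Term n → ℕ
  value ρ (var i) = lookup ρ i
  value ρ (con c) = c
  value ρ (s ⊕ t) = value ρ s + value ρ t

  ⟦_⟧ : ∀ {n} → Formula n → Vec ℕ n → Set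
  ⟦ s ≼ t ⟧  ρ = value ρ s ≤ value ρ t
  ⟦ s ≐ t ⟧  ρ = value ρ s ≡ value ρ t
  ⟦ f ∧′ g ⟧ ρ = ⟦ f ⟧ ρ × ⟦ g ⟧ ρ
  ⟦ f ∨′ g ⟧ ρ = ⟦ f ⟧ ρ ⊎ ⟦ g ⟧ ρ
  ⟦ f ⇒ g ⟧  ρ = ⟦ f ⟧ ρ → ⟦ g ⟧ ρ

  ⟦_⟧? : ∀ {n} (f : Formula n) ρ → Dec (⟦ f ⟧ ρ)
  ⟦ s ≼ t ⟧?  ρ = value ρ s ≤? value ρ t
  ⟦ s ≐ t ⟧?  ρ = value ρ s ≟ value ρ t
  ⟦ f ∧′ g ⟧? ρ = ⟦ f ⟧? ρ ×-dec ⟦ g ⟧? ρ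
  ⟦ f ∨′ g ⟧? ρ = ⟦ f ⟧? ρ ⊎-dec ⟦ g ⟧? ρ
  ⟦ f ⇒ g ⟧?  ρ = ⟦ f ⟧? ρ →-dec ⟦ g ⟧? ρ

  constant : ∀ {n} → ℕ → Vec ℕ (suc n)
  constant {zero}  c = c ∷ []
  constant {suc n} c = 0 ∷ constant c

  projection : ∀ {n} → Fin n → Vec ℕ (suc n)
  projection zero    = 1 ∷ constant 0
  projection (suc i) = 0 ∷ projection i

  linear : ∀ {n} → Term n → Vec ℕ (suc n)
  linear (var i) = projection i
  linear (con c) = constant c
  linear (s ⊕ t) = linear s +ᵛ linear t

  eval-∷ : ∀ {n} c (v : Vec ℕ (suc n)) x ρ → eval (c ∷ v) (x ∷ ρ) ≡ c * x + eval v ρ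
  eval-∷ c (_ ∷ _) x ρ = refl

  eval-constant : ∀ {n} c (ρ : Vec ℕ n) → eval (constant c) ρ ≡ c
  eval-constant c []      = refl
  eval-constant c (x ∷ ρ) = trans (eval-∷ 0 (constant c) x ρ) (eval-constant c ρ)

  eval-variable : ∀ {n} i (ρ : Vec ℕ n) → eval (projection i) ρ ≡ lookup ρ i
  eval-variable zero    (x ∷ ρ) = trans (eval-∷ 1 (constant 0) x ρ)
    (trans (cong (1 * x +_) (eval-constant 0 ρ)) (trans (+-identityʳ _) (*-identityˡ x)))
  eval-variable (suc i) (x ∷ ρ) = trans (eval-∷ 0 (projection i) x ρ) (eval-variable i ρ)

  eval-linear : ∀ {n} (t : Term n) ρ → eval (linear t) ρ ≡ value ρ t
  eval-linear (var i) ρ = eval-variable i ρ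
  eval-linear (con c) ρ = eval-constant c ρ
  eval-linear (s ⊕ t) ρ = trans (eval-+ (linear s) (linear t) ρ) (cong₂ _+_ (eval-linear s ρ) (eval-linear t ρ))

  ineq : ∀ {n} → Term n → Term n → Ineq n
  ineq s t = linear s , linear t

  ineq-sound : ∀ {n} (s t : Term n) ρ → value ρ s ≤ value ρ t → Holds ρ (ineq s t)
  ineq-sound s t ρ = subst₂ _≤_ (sym (eval-linear s ρ)) (sym (eval-linear t ρ))

  Refuter : ℕ → Set
  Refuter n = List (Ineq n) → Bool

  -- Testing the inequalities collected so far before branching saves both branches whenever they
  -- already clash.
  either : ∀ {n} → Refuter n → Refuter n → Refuter n
  either j k is = infeasible is ∨ (j is ∧ k is)

  assume : ∀ {n} → Term n → Term n → Refuter n → Refuter n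
  assume s t k is = k (ineq s t ∷ is)

  refute⁺ refute⁻ : ∀ {n} → Formula n → Refuter n → Refuter n
  refute⁺ (s ≼ t)  k = assume s t k
  refute⁺ (s ≐ t)  k = assume s t (assume t s k)
  refute⁺ (f ∧′ g) k = refute⁺ f (refute⁺ g k)
  refute⁺ (f ∨′ g) k = either (refute⁺ f k) (refute⁺ g k)
  refute⁺ (f ⇒ g)  k = either (refute⁻ f k) (refute⁺ g k)
  -- Integrality enters through such negations; the elimination itself is rational.
  refute⁻ (s ≼ t)  k = assume (con 1 ⊕ t) s k
  refute⁻ (s ≐ t)  k = either (assume (con 1 ⊕ t) s k) (assume (con 1 ⊕ s) t k)
  refute⁻ (f ∧′ g) k = either (refute⁻ f k) (refute⁻ g k)
  refute⁻ (f ∨′ g) k = refute⁻ f (refute⁻ g k)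
  refute⁻ (f ⇒ g)  k = refute⁺ f (refute⁻ g k)

  module _ {n} (ρ : Vec ℕ n) where

    Valid : Refuter n → Set
    Valid k = ∀ is → k is ≡ true → ¬ All (Holds ρ) is

    assumes : ∀ s t k → Valid k → value ρ s ≤ value ρ t → Valid (assume s t k)
    assumes s t k kv h is eq hs = kv _ eq (ineq-sound s t ρ h ∷ hs)

    -- A refutation proves a negation, so a doubly negated disjunction suffices and an implication
    -- can be split without deciding its premise.
    eithers : ∀ {j k} {A B : Set} → (A → Valid j) → (B → Valid k) → ¬ ¬ (A ⊎ B) → Valid (either j k)
    eithers {j} {k} jv kv ab is eq hs with infeasible is in inf
    ... | true  = infeasible-sound ρ is inf hs
    ... | false with j is in ji
    ...   | true = ab λ { (inj₁ a) → jv a is ji hs ; (inj₂ b) → kv b is eq hs }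

    refute⁺-sound : ∀ f {k} → Valid k → ⟦ f ⟧ ρ → Valid (refute⁺ f k)
    refute⁻-sound : ∀ f {k} → Valid k → ¬ ⟦ f ⟧ ρ → Valid (refute⁻ f k)
    refute⁺-sound (s ≼ t)  v h = assumes s t _ v h
    refute⁺-sound (s ≐ t)  v h = assumes s t _ (assumes t s _ v (≤-reflexive (sym h))) (≤-reflexive h)
    refute⁺-sound (f ∧′ g) v (h , h′) = refute⁺-sound f (refute⁺-sound g v h′) h
    refute⁺-sound (f ∨′ g) v h = eithers (refute⁺-sound f v) (refute⁺-sound g v) (λ ¬h → ¬h h)
    refute⁺-sound (f ⇒ g)  v h = eithers (refute⁻-sound f v) (refute⁺-sound g v)
      (λ ¬h → ¬h (inj₁ λ x → ¬h (inj₂ (h x))))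
    refute⁻-sound (s ≼ t)  v h = assumes (con 1 ⊕ t) s _ v (≰⇒> h)
    refute⁻-sound (s ≐ t)  v h = eithers (assumes (con 1 ⊕ t) s _ v) (assumes (con 1 ⊕ s) t _ v)
      λ ¬h → case <-cmp (value ρ s) (value ρ t) of λ
        { (tri< lt _ _) → ¬h (inj₂ lt) ; (tri≈ _ eq _) → h eq ; (tri> _ _ gt) → ¬h (inj₁ gt) }
    refute⁻-sound (f ∧′ g) v h = eithers (refute⁻-sound f v) (refute⁻-sound g v)
      (λ ¬h → ¬h (inj₁ λ x → ¬h (inj₂ λ y → h (x , y))))
    refute⁻-sound (f ∨′ g) v h = refute⁻-sound f (refute⁻-sound g v (h ∘ inj₂)) (h ∘ inj₁)
    refute⁻-sound (f ⇒ g)  v h is eq hs = ⟦f⟧-stable (λ x → refute⁺-sound f (refute⁻-sound g v (λ y → h (λ _ → y))) x is eq hs)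
      where
      ⟦f⟧-stable : ¬ ¬ ⟦ f ⟧ ρ
      ⟦f⟧-stable ¬f = h (λ x → ⊥-elim (¬f x))

  abstract
    valid : ∀ {n} (f : Formula n) → refute⁻ f infeasible [] ≡ true → ∀ ρ → ⟦ f ⟧ ρ
    valid f eq ρ = decidable-stable (⟦ f ⟧? ρ) λ ¬f →
      refute⁻-sound ρ f (infeasible-sound ρ) ¬f [] eq []

open LinearArithmetic

-- Arithmetic of two crossing separations

-- The nine cells of two crossing separations σ and τ: the first letter is the position with respect
-- to σ, the second with respect to τ (l and r for the two sides, m for the separator).  The variables
-- are numbered in the order that keeps Fourier–Motzkin elimination small.
rl ll rm ml rr mr lr lm mm : Term 9
rl = var 0F
ll = var 1F
rm = var 2F
ml = var 3F
rr = var 4F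
mr = var 5F
lr = var 6F
lm = var 7F
mm = var 8F

-- The two equations say that both separators have five vertices. Together they make the boundaries
-- of opposite corners add up to ten, which is the submodularity used everywhere.
sums : Formula 9 → Formula 9
sums f = lm ⊕ mm ⊕ rm ≐ con 5 ⇒ ml ⊕ mm ⊕ mr ≐ con 5 ⇒ f

-- A nonempty corner c has its neighbours in x, mm and y, of which e are known not to be neighbours.
corner : Term 9 → Term 9 → Term 9 → ℕ → Formula 9
corner c x y e = c ≼ con 0 ∨′ con (5 + e) ≼ x ⊕ mm ⊕ y

-- Side `l` of the first separation is the smallest side A. If `rr` is not empty, its boundary gives
-- `mr` at least `lm`; if it is empty, comparing A with `lr ⊕ mr ⊕ rr` gives even `ll ⊕ lm`. The
-- same holds for `ml`, and `ml ⊕ mr` is at most 5, so `lm` is at most 2. A nonempty `ll` excludes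
-- an empty `rr`, for otherwise its boundary would have at most four vertices; hence that boundary
-- is at most 5.
fragment-arith = valid (sums (
    con 1 ≼ lm ⇒ con 3 ≼ ll ⊕ lm ⊕ lr ⇒
    ll ⊕ lm ⊕ lr ≼ rl ⊕ rm ⊕ rr ⇒ ll ⊕ lm ⊕ lr ≼ ll ⊕ ml ⊕ rl ⇒ ll ⊕ lm ⊕ lr ≼ lr ⊕ mr ⊕ rr ⇒
    (ll ≼ con 1 ∨′ con 6 ≼ lm ⊕ mm ⊕ ml) ⇒ (lr ≼ con 1 ∨′ con 6 ≼ lm ⊕ mm ⊕ mr) ⇒
    corner rr rm mr 0 ⇒ corner rl rm ml 0 ⇒ corner ll lm ml 0 ⇒ corner lr lm mr 0 ⇒
    lm ≼ con 2 ∧′ ll ≼ con 1 ∧′ (con 1 ≼ ll ⇒ lm ⊕ mm ⊕ ml ≼ con 5) ∧′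
    (con 1 ≼ ll ⇒ lr ≼ con 0 ⇒ con 2 ≼ mr))) refl

-- The sizes force `lm` and `ll` to be 1 and `lr` to be 0. An empty `rr` would give `mr` at least 2
-- and leave `ll` a boundary of at most 4. So both opposite boundaries are exactly 5.
halved-arith = valid (sums (
    ll ⊕ lm ⊕ lr ≐ con 2 ⇒ con 1 ≼ lm ⇒ con 1 ≼ ll ⇒ con 2 ≼ lr ⊕ mr ⊕ rr ⇒
    corner ll lm ml 0 ⇒ corner rr rm mr 0 ⇒
    ll ≼ con 1 ∧′ mr ≐ con 1 ∧′ lm ⊕ mm ⊕ ml ≼ con 5)) refl

-- The whole side lies in `lm`, so `rm ⊕ mm` is 3. Whether `rl` is empty or not, `ml` is at least 2,
-- and likewise `mr`; the vertex in `mm` is the remaining one of the five.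
split-arith = valid (sums (
    ll ⊕ lm ⊕ lr ≐ con 2 ⇒ con 2 ≼ lm ⇒ con 1 ≼ mm ⇒
    con 2 ≼ ll ⊕ ml ⊕ rl ⇒ con 2 ≼ lr ⊕ mr ⊕ rr ⇒
    corner rl rm ml 0 ⇒ corner rr rm mr 0 ⇒
    mm ≼ con 1 ∧′ ml ≐ con 2)) refl

opposite-arith = valid (sums (
    con 5 ≼ rm ⊕ mm ⊕ mr ⇒ lm ⊕ mm ⊕ ml ≼ con 5)) refl

-- By the surplus 1, a nonempty `rl` has a boundary of at least 6, which leaves `lr` at most 4 and
-- so makes it empty; the sizes of the sides then clash. The same applies to `rr`. Hence `rm` is a
-- whole side.
tip-arith = valid (sums (
    con 1 ≼ lm ⇒ con 1 ≼ mm ⇒ con 1 ≼ rm ⇒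
    con 2 ≼ ll ⊕ ml ⊕ rl ⇒ con 2 ≼ lr ⊕ mr ⊕ rr ⇒ con 2 ≼ ll ⊕ lm ⊕ lr ⇒ con 2 ≼ rl ⊕ rm ⊕ rr ⇒
    corner rl rm ml 1 ⇒ corner rr rm mr 1 ⇒ corner ll lm ml 0 ⇒ corner lr lm mr 0 ⇒
    rl ≼ con 0 ∧′ rr ≼ con 0 ∧′ rm ≐ con 2 ∧′ mm ≐ con 1)) refl

-- The boundary of `rr` limits that of `ll` to 5, so the two bounds by 4 are tight and `mm` is 3.
-- All boundaries on side `l` are then 5, less than the 7 that the corner with surplus 2 would
-- require.
final-arith = valid (sums (
    con 1 ≼ ml ⇒ con 1 ≼ lm ⇒ con 4 ≼ ml ⊕ mm ⇒ con 4 ≼ lm ⊕ mm ⇒ con 5 ≼ rm ⊕ mm ⊕ mr ⇒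
    ((lm ⊕ mm ⊕ ml ≼ con 5 ∧′ ll ≼ con 1) ∧′ corner lr lm mr 2 ∨′
     (lm ⊕ mm ⊕ mr ≼ con 5 ∧′ lr ≼ con 1) ∧′ corner ll lm ml 2) ⇒
    mm ≐ con 3 ∧′ ml ≐ con 1 ∧′ lm ≐ con 1 ∧′ mr ≐ con 1 ∧′ ll ⊕ lm ⊕ lr ≼ con 2)) refl

-- Counting with decidable predicates

module Counting where

  indicator : Bool → ℕ
  indicator b = if b then 1 else 0

  count : ∀ {n} {P : Pred (Fin n) 0ℓ} → Decidable P → ℕ
  count {zero}  P? = 0
  count {suc n} P? = indicator (does (P? zero)) + count (P? ∘ suc)

  abstract
    count-mono-+ : ∀ {n} {P Q R : Pred (Fin n) 0ℓ} (P? : Decidable P) (Q? : Decidable Q) (R? : Decidable R) →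
                   (∀ {v} → P v → Q v ⊎ R v) → count P? ≤ count Q? + count R?
    count-mono-+ {zero}  P? Q? R? P⊆Q∪R = z≤n
    count-mono-+ {suc n} P? Q? R? P⊆Q∪R with count-mono-+ (P? ∘ suc) (Q? ∘ suc) (R? ∘ suc) P⊆Q∪R
    ... | ih with P? zero | Q? zero | R? zero
    ...   | no _  | no _  | no _  = ih
    ...   | no _  | no _  | yes _ = ≤-trans ih (+-monoʳ-≤ _ (n≤1+n _))
    ...   | no _  | yes _ | no _  = m≤n⇒m≤1+n ih
    ...   | no _  | yes _ | yes _ = m≤n⇒m≤1+n (≤-trans ih (+-monoʳ-≤ _ (n≤1+n _)))
    ...   | yes _ | yes _ | no _  = s≤s ih
    ...   | yes _ | yes _ | yes _ = s≤s (≤-trans ih (+-monoʳ-≤ _ (n≤1+n _)))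
    ...   | yes _ | no _  | yes _ = ≤-trans (s≤s ih) (≤-reflexive (sym (+-suc _ _)))
    ...   | yes p | no ¬q | no ¬r = ⊥-elim ([ ¬q , ¬r ]′ (P⊆Q∪R p))

    count-mono-⊎ : ∀ {n} {P Q R : Pred (Fin n) 0ℓ} (P? : Decidable P) (Q? : Decidable Q) (R? : Decidable R) →
                   (∀ {v} → Q v → P v) → (∀ {v} → R v → P v) → (∀ {v} → Q v → ¬ R v) →
                   count Q? + count R? ≤ count P?
    count-mono-⊎ {zero}  P? Q? R? Q⊆P R⊆P Q∩R = z≤n
    count-mono-⊎ {suc n} P? Q? R? Q⊆P R⊆P Q∩R
      with count-mono-⊎ (P? ∘ suc) (Q? ∘ suc) (R? ∘ suc) Q⊆P R⊆P Q∩R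
    ... | ih with P? zero | Q? zero | R? zero
    ...   | no _  | no _  | no _  = ih
    ...   | yes _ | no _  | no _  = m≤n⇒m≤1+n ih
    ...   | yes _ | yes _ | no _  = s≤s ih
    ...   | yes _ | no _  | yes _ = ≤-trans (≤-reflexive (+-suc _ _)) (s≤s ih)
    ...   | _     | yes q | yes r = ⊥-elim (Q∩R q r)
    ...   | no ¬p | yes q | _     = ⊥-elim (¬p (Q⊆P q))
    ...   | no ¬p | _     | yes r = ⊥-elim (¬p (R⊆P r))

  none? : ∀ {n} → Decidable {A = Fin n} (λ _ → ⊥)
  none? _ = no id

  abstract
    count-none : ∀ {n} → count (none? {n}) ≡ 0
    count-none {zero}  = refl
    count-none {suc n} = count-none {n}

  module _ {n} {P Q : Pred (Fin n) 0ℓ} (P? : Decidable P) (Q? : Decidable Q) where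

    abstract
      count-mono : (∀ {v} → P v → Q v) → count P? ≤ count Q?
      count-mono P⊆Q = subst (count P? ≤_) (trans (cong (count Q? +_) (count-none {n})) (+-identityʳ _))
        (count-mono-+ P? Q? none? (inj₁ ∘ P⊆Q))

  module _ {n} {P A B C : Pred (Fin n) 0ℓ}
           (P? : Decidable P) (A? : Decidable A) (B? : Decidable B) (C? : Decidable C) where

    abstract
      count-mono-+₃ : (∀ {v} → P v → A v ⊎ B v ⊎ C v) → count P? ≤ count A? + count B? + count C?
      count-mono-+₃ P⊆ = begin
        count P?                               ≤⟨ count-mono-+ P? A? (λ v → B? v ⊎-dec C? v) P⊆ ⟩
        count A? + count (λ v → B? v ⊎-dec C? v) ≤⟨ +-monoʳ-≤ (count A?) (count-mono-+ (λ v → B? v ⊎-dec C? v) B? C? id) ⟩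
        count A? + (count B? + count C?)       ≡⟨ +-assoc (count A?) _ _ ⟨
        count A? + count B? + count C?         ∎
        where open ≤-Reasoning

      count-mono-⊎₃ : (∀ {v} → A v → P v) → (∀ {v} → B v → P v) → (∀ {v} → C v → P v) →
                      (∀ {v} → A v → ¬ B v) → (∀ {v} → A v → ¬ C v) → (∀ {v} → B v → ¬ C v) →
                      count A? + count B? + count C? ≤ count P?
      count-mono-⊎₃ A⊆ B⊆ C⊆ AB AC BC = begin
        count A? + count B? + count C?           ≡⟨ +-assoc (count A?) _ _ ⟩
        count A? + (count B? + count C?)         ≤⟨ +-monoʳ-≤ (count A?) (count-mono-⊎ (λ v → B? v ⊎-dec C? v) B? C? inj₁ inj₂ BC) ⟩
        count A? + count (λ v → B? v ⊎-dec C? v) ≤⟨ count-mono-⊎ P? A? (λ v → B? v ⊎-dec C? v) A⊆ [ B⊆ , C⊆ ]′ (λ a → [ AB a , AC a ]′) ⟩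
        count P?                                 ∎
        where open ≤-Reasoning

  abstract
    witness : ∀ {n} {P : Pred (Fin n) 0ℓ} (P? : Decidable P) → 1 ≤ count P? → ∃ P
    witness {suc n} P? 1≤ with P? zero
    ... | yes p = zero , p
    ... | no _  with witness (P? ∘ suc) 1≤
    ...   | v , p = suc v , p

    count-≟ : ∀ {n} (x : Fin n) → count (Fin._≟ x) ≡ 1
    count-≟ {suc n} zero    = cong suc (n≤0⇒n≡0 (subst (count {n} (λ v → suc v Fin.≟ zero) ≤_) (count-none {n})
      (count-mono {n} (λ v → suc v Fin.≟ zero) none? (λ ()))))
    count-≟ {suc n} (suc x) = trans (≤-antisym
      (count-mono (λ v → suc v Fin.≟ suc x) (Fin._≟ x) Fin.suc-injective)
      (count-mono (Fin._≟ x) (λ v → suc v Fin.≟ suc x) (cong Fin.suc))) (count-≟ x)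

  module _ {n} {P : Pred (Fin n) 0ℓ} (P? : Decidable P) where

    _without_ : (x : Fin n) → Decidable (λ v → P v × v ≢ x)
    _without_ x v = P? v ×-dec ¬? (v Fin.≟ x)

    abstract
      count-without : ∀ x → count P? ≤ 1 + count (_without_ x)
      count-without x = subst (λ k → count P? ≤ k + count (_without_ x)) (count-≟ x)
        (count-mono-+ P? (Fin._≟ x) (_without_ x) (λ {v} p → case v Fin.≟ x of λ { (yes e) → inj₁ e ; (no ne) → inj₂ (p , ne) }))

      without-count : ∀ {x} → P x → 1 + count (_without_ x) ≤ count P?
      without-count {x} p = subst (λ k → k + count (_without_ x) ≤ count P?) (count-≟ x)
        (count-mono-⊎ P? (Fin._≟ x) (_without_ x) (λ { refl → p }) proj₁ (λ e q → proj₂ q e))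

      witness₂ : 2 ≤ count P? → ∃₂ λ x y → P x × P y × y ≢ x
      witness₂ 2≤ with witness P? (≤-trans (n≤1+n 1) 2≤)
      ... | x , px with witness (_without_ x) (≤-pred (≤-trans 2≤ (count-without x)))
      ...   | y , py , ne = x , y , px , py , ne

      count-all-but : ∀ x → (∀ {v} → P v → v ≡ x) → count P? ≤ 1
      count-all-but x h = subst (count P? ≤_) (count-≟ x) (count-mono P? (Fin._≟ x) h)

  abstract
    unique-≤-count : ∀ {n} {P : Pred (Fin n) 0ℓ} (P? : Decidable P) {xs} →
                     Unique xs → All P xs → length xs ≤ count P?
    unique-≤-count P? []        []       = z≤n
    unique-≤-count P? {x ∷ xs} (x∉ ∷ u) (p ∷ ps) = ≤-trans
      (s≤s (unique-≤-count (P? without x) u (All.zip (ps , All.map (λ ne e → ne (sym e)) x∉))))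
      (without-count P? p)

    some-≤-count : ∀ {n} {P : Pred (Fin n) 0ℓ} (P? : Decidable P) {x} → P x → 1 ≤ count P?
    some-≤-count P? p = unique-≤-count P? ([] ∷ []) (p ∷ [])

    count-≤-1 : ∀ {n} {P : Pred (Fin n) 0ℓ} (P? : Decidable P) → count P? ≤ 1 → ∀ {x y} → P x → P y → x ≡ y
    count-≤-1 P? ≤1 {x} {y} px py with x Fin.≟ y
    ... | yes e = e
    ... | no ne = ⊥-elim (<⇒≱ (unique-≤-count P? ((ne ∷ []) ∷ [] ∷ []) (px ∷ py ∷ [])) ≤1)

    count-≤-2 : ∀ {n} {P : Pred (Fin n) 0ℓ} (P? : Decidable P) → count P? ≤ 2 →
                ∀ {x y z} → P x → P y → P z → x ≢ y → z ≡ x ⊎ z ≡ y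
    count-≤-2 P? ≤2 {x} {y} {z} px py pz x≢y with z Fin.≟ x | z Fin.≟ y
    ... | yes e | _     = inj₁ e
    ... | no _  | yes e = inj₂ e
    ... | no ne | no ne′ = ⊥-elim (<⇒≱ (unique-≤-count P? ((ne ∷ ne′ ∷ []) ∷ (x≢y ∷ []) ∷ [] ∷ []) (pz ∷ px ∷ py ∷ [])) ≤2)

  count-punchIn : ∀ {n} {P : Pred (Fin (suc n)) 0ℓ} (P? : Decidable P) y →
                  count P? ≡ indicator (does (P? y)) + count (P? ∘ punchIn y)
  count-punchIn           P? zero    = refl
  count-punchIn {suc n}   P? (suc y) = begin
    i₀ + count (P? ∘ suc)            ≡⟨ cong (i₀ +_) (count-punchIn (P? ∘ suc) y) ⟩
    i₀ + (i₁ + rest)                 ≡⟨ +-assoc i₀ i₁ rest ⟨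
    i₀ + i₁ + rest                   ≡⟨ cong (_+ rest) (+-comm i₀ i₁) ⟩
    i₁ + i₀ + rest                   ≡⟨ +-assoc i₁ i₀ rest ⟩
    i₁ + (i₀ + rest)                 ∎
    where
    open ≡-Reasoning
    i₀ = indicator (does (P? zero))
    i₁ = indicator (does (P? (suc y)))
    rest = count (P? ∘ suc ∘ punchIn y)

open Counting

-- Separations of a 5-connected graph

data Place : Set where
  cut  : Place
  side : Bool → Place

side-injective : ∀ {p q} → side p ≡ side q → p ≡ q
side-injective refl = refl

_≟ᵖ_ : (x y : Place) → Dec (x ≡ y)
cut    ≟ᵖ cut    = yes refl
cut    ≟ᵖ side _ = no λ ()
side _ ≟ᵖ cut    = no λ ()
side p ≟ᵖ side q = map′ (cong side) side-injective (p Bool.≟ q)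

not-≢ : ∀ p → side (not p) ≢ side p
not-≢ true  ()
not-≢ false ()

place-cases : ∀ p x → x ≡ side p ⊎ x ≡ cut ⊎ x ≡ side (not p)
place-cases p     cut          = inj₂ (inj₁ refl)
place-cases true  (side true)  = inj₁ refl
place-cases true  (side false) = inj₂ (inj₂ refl)
place-cases false (side true)  = inj₂ (inj₂ refl)
place-cases false (side false) = inj₁ refl

clash : ∀ {A : Set} {x : Place} {p} → x ≡ cut → x ≡ side p → A
clash refl ()

opposed : ∀ {A : Set} {x : Place} {p} → x ≡ side p → x ≡ side (not p) → A
opposed {p = p} e f = ⊥-elim (not-≢ p (trans (sym f) e))

-- Connectivity through sets closed up to `R` instead of walks, the form that suits counting; `X`
-- and `R` may overlap.
FiveConnected : ∀ {N} → (Fin N → Fin N → Set) → Set₁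
FiveConnected {N} Adj = ∀ {X R : Pred (Fin N) 0ℓ} (X? : Decidable X) (R? : Decidable R) →
  (∀ {u v} → X u → ¬ R u → Adj u v → X v ⊎ R v) →
  ∃ (λ u → X u × ¬ R u) → ∃ (λ v → ¬ X v × ¬ R v) → 5 ≤ count R?

module Separations {N} (Adj : Fin N → Fin N → Set) (adj? : ∀ u v → Dec (Adj u v))
  (adj-sym : ∀ {u v} → Adj u v → Adj v u) (adj-irrefl : ∀ {u} → ¬ Adj u u)
  (5<N : 5 < N)
  (five-connected : FiveConnected Adj)
  where

  V : Set
  V = Fin N

  -- The neighbourhood of `c` separates `c` from any other non-neighbour; if there is none, the
  -- order of the graph gives the bound.
  degree : ∀ c → 5 ≤ count (adj? c)
  degree c = decidable-stable (5 ≤? _) λ small → small (≤-pred (begin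
    6                                       ≤⟨ 5<N ⟩
    N                                       ≡⟨ count-true ⟨
    count {N} (λ _ → yes tt)                ≤⟨ count-mono-+ (λ _ → yes tt) (Fin._≟ c) (adj? c) (λ {v} _ → near small v) ⟩
    count (Fin._≟ c) + count (adj? c)       ≡⟨ cong (_+ count (adj? c)) (count-≟ c) ⟩
    1 + count (adj? c)                      ∎))
    where
    open ≤-Reasoning
    count-true : ∀ {n} → count {n} (λ _ → yes tt) ≡ n
    count-true {zero}  = refl
    count-true {suc n} = cong suc count-true
    near : ¬ 5 ≤ count (adj? c) → ∀ v → v ≡ c ⊎ Adj c v
    near small v with v Fin.≟ c | adj? c v
    ... | yes e | _     = inj₁ e
    ... | no _  | yes a = inj₂ a
    ... | no ne | no ¬a = ⊥-elim (small (five-connected (Fin._≟ c) (adj? c)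
      (λ { refl _ a → inj₂ a }) (c , refl , adj-irrefl) (v , ne , ¬a)))

  -- At least five neighbours within at most five places leave no place free.
  five-neighbours : ∀ {Z : Pred V 0ℓ} (Z? : Decidable Z) c → (∀ {v} → Adj c v → Z v) →
                    count Z? ≤ 5 → ∀ {z} → Z z → Adj c z
  five-neighbours Z? c N⊆Z Z≤5 {z} Zz with adj? c z
  ... | yes a = a
  ... | no ¬a = ⊥-elim (<⇒≱ (≤-trans (s≤s (≤-trans (degree c)
    (count-mono (adj? c) (Z? without z) (λ { a → N⊆Z a , λ { refl → ¬a a } })))) (without-count Z? Zz)) Z≤5)

  at : (σ : V → Place) → ∀ x → Decidable (λ v → σ v ≡ x)
  at σ x v = σ v ≟ᵖ x

  size : (V → Place) → Place → ℕ
  size σ x = count (at σ x)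

  record Good (σ : V → Place) : Set where
    field
      size-cut : size σ cut ≡ 5
      size-side : ∀ p → 2 ≤ size σ (side p)
      separated : ∀ u v → σ u ≡ side true → σ v ≡ side false → ¬ Adj u v

    apart : ∀ {p u v} → σ u ≡ side p → Adj u v → σ v ≡ side p ⊎ σ v ≡ cut
    apart {p} {u} {v} eq a with place-cases p (σ v)
    ... | inj₁ same        = inj₁ same
    ... | inj₂ (inj₁ c)    = inj₂ c
    apart {true}  {u} {v} eq a | inj₂ (inj₂ other) = ⊥-elim (separated u v eq other a)
    apart {false} {u} {v} eq a | inj₂ (inj₂ other) = ⊥-elim (separated v u other eq (adj-sym a))

    abstract
      -- Without such a neighbour, the other four vertices of the separator would already cut the
      -- side off from `t`.
      cut-meets-side : ∀ p {t} → σ t ≡ cut → ∃ λ v → σ v ≡ side p × Adj t v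
      cut-meets-side p {t} tc with Fin.any? (λ v → at σ (side p) v ×-dec adj? t v)
      ... | yes found = found
      ... | no none = ⊥-elim (<⇒≱ (≤-trans (s≤s bound) (without-count (at σ cut) tc)) (≤-reflexive size-cut))
        where
        bound : 5 ≤ count (at σ cut without t)
        bound = five-connected (at σ (side p)) (at σ cut without t)
          (λ {u} {v} u∈ _ a → case apart u∈ a of λ
            { (inj₁ same) → inj₁ same
            ; (inj₂ c) → inj₂ (c , λ { refl → none (u , u∈ , adj-sym a) }) })
          (let u , u∈ = witness (at σ (side p)) (≤-trans (n≤1+n 1) (size-side p))
           in u , u∈ , λ (c , _) → clash c u∈)
          (t , (λ t∈ → clash tc t∈) , λ (_ , ne) → ne refl)

  open Good

  module Region {X R : Pred V 0ℓ} (X? : Decidable X) (R? : Decidable R) where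

    region : V → Place
    region v = if does (R? v) then cut else side (does (X? v))

    region-cut : ∀ {v} → R v → region v ≡ cut
    region-cut {v} r with R? v
    ... | yes _ = refl
    ... | no ¬r = ⊥-elim (¬r r)

    region-true : ∀ {v} → X v → ¬ R v → region v ≡ side true
    region-true {v} x ¬r with R? v | X? v
    ... | yes r | _     = ⊥-elim (¬r r)
    ... | no _  | yes _ = refl
    ... | no _  | no ¬x = ⊥-elim (¬x x)

    region-false : ∀ {v} → ¬ X v → ¬ R v → region v ≡ side false
    region-false {v} ¬x ¬r with R? v | X? v
    ... | yes r | _     = ⊥-elim (¬r r)
    ... | no _  | yes x = ⊥-elim (¬x x)
    ... | no _  | no _  = refl

    region-cut⁻ : ∀ {v} → region v ≡ cut → R v
    region-cut⁻ {v} eq with R? v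
    ... | yes r = r
    region-cut⁻ {v} () | no _

    region-true⁻ : ∀ {v} → region v ≡ side true → X v × ¬ R v
    region-true⁻ {v} eq with R? v | X? v
    ... | no ¬r | yes x = x , ¬r

    region-false⁻ : ∀ {v} → region v ≡ side false → ¬ X v × ¬ R v
    region-false⁻ {v} eq with R? v | X? v
    ... | no ¬r | no ¬x = ¬x , ¬r

    module _ (R≤5 : count R? ≤ 5)
             (2≤X : 2 ≤ count (λ v → X? v ×-dec ¬? (R? v)))
             (2≤Y : 2 ≤ count (λ v → ¬? (X? v) ×-dec ¬? (R? v)))
             (closed : ∀ {u v} → X u → ¬ R u → Adj u v → X v ⊎ R v) where

      region-good : Good region
      region-good .size-cut = ≤-antisym
        (≤-trans (count-mono (at region cut) R? region-cut⁻) R≤5)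
        (≤-trans (five-connected X? R? closed (witness _ (≤-trans (n≤1+n 1) 2≤X)) (witness _ (≤-trans (n≤1+n 1) 2≤Y)))
                 (count-mono R? (at region cut) region-cut))
      region-good .size-side true  = ≤-trans 2≤X (count-mono _ (at region (side true)) (λ (x , r) → region-true x r))
      region-good .size-side false = ≤-trans 2≤Y (count-mono _ (at region (side false)) (λ (x , r) → region-false x r))
      region-good .separated u v ue ve a with region-true⁻ ue | region-false⁻ ve
      ... | x , ¬r | ¬x , ¬r′ = [ ¬x , ¬r′ ]′ (closed x ¬r a)

  -- Corners of two crossing separations

  module Crossing {σ τ : V → Place} (gσ : Good σ) (gτ : Good τ) where

    Cell : Place → Place → Pred V 0ℓ
    Cell x y v = σ v ≡ x × τ v ≡ y

    cell? : ∀ x y → Decidable (Cell x y)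
    cell? x y v = at σ x v ×-dec at τ y v

    # : Place → Place → ℕ
    # x y = count (cell? x y)

    row : ∀ x q → # x (side q) + # x cut + # x (side (not q)) ≡ size σ x
    row x q = ≤-antisym
      (count-mono-⊎₃ (at σ x) (cell? x (side q)) (cell? x cut) (cell? x (side (not q))) proj₁ proj₁ proj₁
        (λ (_ , e) (_ , f) → clash f e) (λ (_ , e) (_ , f) → opposed e f) (λ (_ , e) (_ , f) → clash e f))
      (count-mono-+₃ (at σ x) (cell? x (side q)) (cell? x cut) (cell? x (side (not q)))
        (λ {v} e → Sum.map (e ,_) (Sum.map (e ,_) (e ,_)) (place-cases q (τ v))))

    column : ∀ y p → # (side p) y + # cut y + # (side (not p)) y ≡ size τ y
    column y p = ≤-antisym
      (count-mono-⊎₃ (at τ y) (cell? (side p) y) (cell? cut y) (cell? (side (not p)) y) proj₂ proj₂ proj₂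
        (λ (e , _) (f , _) → clash f e) (λ (e , _) (f , _) → opposed e f) (λ (e , _) (f , _) → clash e f))
      (count-mono-+₃ (at τ y) (cell? (side p) y) (cell? cut y) (cell? (side (not p)) y)
        (λ {v} e → Sum.map (_, e) (Sum.map (_, e) (_, e)) (place-cases p (σ v))))

    cells : Bool → Bool → Vec ℕ 9
    cells p q = # (side (not p)) (side q) ∷ # (side p) (side q) ∷ # (side (not p)) cut ∷ # cut (side q)
              ∷ # (side (not p)) (side (not q)) ∷ # cut (side (not q)) ∷ # (side p) (side (not q))
              ∷ # (side p) cut ∷ # cut cut ∷ []

    τ-cut : ∀ p → # (side p) cut + # cut cut + # (side (not p)) cut ≡ 5
    τ-cut p = trans (column cut p) (gτ .size-cut)

    σ-cut : ∀ q → # cut (side q) + # cut cut + # cut (side (not q)) ≡ 5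
    σ-cut q = trans (row cut q) (gσ .size-cut)

    boundary : Bool → Bool → ℕ
    boundary p q = # (side p) cut + # cut cut + # cut (side q)

    Boundary : Bool → Bool → Pred V 0ℓ
    Boundary p q v = Cell (side p) cut v ⊎ Cell cut cut v ⊎ Cell cut (side q) v

    boundary? : ∀ p q → Decidable (Boundary p q)
    boundary? p q v = cell? (side p) cut v ⊎-dec cell? cut cut v ⊎-dec cell? cut (side q) v

    count-boundary : ∀ p q → count (boundary? p q) ≤ boundary p q
    count-boundary p q = count-mono-+₃ (boundary? p q) (cell? (side p) cut) (cell? cut cut) (cell? cut (side q)) id

    exit : ∀ {p q u v} → Cell (side p) (side q) u → Adj u v → Cell (side p) (side q) v ⊎ Boundary p q v
    exit (pu , qu) a with apart gσ pu a | apart gτ qu a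
    ... | inj₁ p | inj₁ q = inj₁ (p , q)
    ... | inj₁ p | inj₂ c = inj₂ (inj₁ (p , c))
    ... | inj₂ c | inj₁ q = inj₂ (inj₂ (inj₂ (c , q)))
    ... | inj₂ c | inj₂ d = inj₂ (inj₂ (inj₁ (c , d)))

    boundary-disjoint : ∀ {p q v} → Boundary p q v → ¬ Cell (side p) (side q) v
    boundary-disjoint (inj₁ (_ , c))        (_ , e) = clash c e
    boundary-disjoint (inj₂ (inj₁ (_ , c))) (_ , e) = clash c e
    boundary-disjoint (inj₂ (inj₂ (c , _))) (e , _) = clash c e

    module _ p q {X E : Pred V 0ℓ} (X? : Decidable X) (E? : Decidable E)
             (X⊆ : ∀ {v} → X v → Cell (side p) (side q) v) (X≠∅ : ∃ X)
             (E⊆ : ∀ {v} → E v → Cell cut cut v) (no-edge : ∀ {u v} → X u → E v → ¬ Adj u v) where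

      corner-rest? : Decidable (λ v → Cell (side p) (side q) v × ¬ X v)
      corner-rest? v = cell? (side p) (side q) v ×-dec ¬? (X? v)

      -- The neighbours of `X` outside `X` lie in the boundary without `E` or in the rest of the
      -- corner, and these vertices separate `X` from the opposite side of `σ`.
      part-of-corner : 5 + count E? ≤ boundary p q + count corner-rest?
      part-of-corner = begin
        5 + count E?                                        ≤⟨ +-monoˡ-≤ _ (five-connected X? R? closed source target) ⟩
        count R? + count E?                                 ≤⟨ count-mono-⊎ S? R? E? Sum.[ inj₁ ∘ proj₁ , inj₂ ] (λ e → inj₁ (inj₂ (inj₁ (E⊆ e)))) disjoint ⟩
        count S?                                            ≤⟨ count-mono-+ S? (boundary? p q) corner-rest? id ⟩
        count (boundary? p q) + count corner-rest?          ≤⟨ +-monoˡ-≤ _ (count-boundary p q) ⟩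
        boundary p q + count corner-rest?                   ∎
        where
        open ≤-Reasoning
        S? = λ v → boundary? p q v ⊎-dec corner-rest? v
        R? = λ v → (boundary? p q v ×-dec ¬? (E? v)) ⊎-dec corner-rest? v
        disjoint : ∀ {v} → (Boundary p q v × ¬ E v) ⊎ (Cell (side p) (side q) v × ¬ X v) → ¬ E v
        disjoint (inj₁ (_ , ¬e))      e = ¬e e
        disjoint (inj₂ ((f , _) , _)) e = clash (proj₁ (E⊆ e)) f
        closed : ∀ {u v} → X u → _ → Adj u v → X v ⊎ ((Boundary p q v × ¬ E v) ⊎ (Cell (side p) (side q) v × ¬ X v))
        closed {u} {v} x _ a with exit (X⊆ x) a
        ... | inj₂ b = inj₂ (inj₁ (b , λ e → no-edge x e a))
        ... | inj₁ c with X? v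
        ...   | yes x′ = inj₁ x′
        ...   | no ¬x  = inj₂ (inj₂ (c , ¬x))
        source = let u , x = X≠∅ in u , x , [ (λ (b , _) → boundary-disjoint b (X⊆ x)) , (λ (_ , ¬x) → ¬x x) ]′
        target = let w , e = witness (at σ (side (not p))) (≤-trans (n≤1+n 1) (gσ .size-side (not p)))
                  in w , (λ x → opposed (proj₁ (X⊆ x)) e)
                       , [ (λ { (inj₁ (f , _) , _) → opposed f e
                              ; (inj₂ (inj₁ (c , _)) , _) → clash c e
                              ; (inj₂ (inj₂ (c , _)) , _) → clash c e })
                         , (λ ((f , _) , _) → opposed f e) ]′

    whole-corner : ∀ p q {E : Pred V 0ℓ} (E? : Decidable E) → (∀ {v} → E v → Cell cut cut v) →
                   (∀ {u v} → Cell (side p) (side q) u → E v → ¬ Adj u v) →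
                   # (side p) (side q) ≤ 0 ⊎ 5 + count E? ≤ boundary p q
    whole-corner p q E? E⊆ no-edge with # (side p) (side q) ≤? 0
    ... | yes empty = inj₁ empty
    ... | no ¬empty = inj₂ (begin
      5 + count E?                                        ≤⟨ part-of-corner p q (cell? _ _) E? id (witness (cell? _ _) (≰⇒> ¬empty)) E⊆ no-edge ⟩
      boundary p q + count (corner-rest? p q (cell? _ _) E? id (witness (cell? _ _) (≰⇒> ¬empty)) E⊆ no-edge)
                                                          ≤⟨ +-monoʳ-≤ (boundary p q) (count-mono {N} _ none? (λ (c , ¬c) → ¬c c)) ⟩
      boundary p q + count {N} none?                      ≡⟨ cong (boundary p q +_) (count-none {N}) ⟩
      boundary p q + 0                                    ≡⟨ +-identityʳ _ ⟩
      boundary p q                                        ∎)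
      where open ≤-Reasoning

    corner₀ : ∀ p q → # (side p) (side q) ≤ 0 ⊎ 5 ≤ boundary p q
    corner₀ p q = Sum.map₂ (≤-trans (m≤m+n 5 _)) (whole-corner p q none? (λ ()) (λ _ ()))

    occupied : ∀ {p q v} → Cell (side p) (side q) v → 5 ≤ boundary p q
    occupied {p} {q} v∈ with corner₀ p q
    ... | inj₂ 5≤    = 5≤
    ... | inj₁ empty = ⊥-elim (<⇒≱ (some-≤-count (cell? (side p) (side q)) v∈) empty)

    -- Being alone in its corner, `c` has all its neighbours in a boundary of at most five vertices,
    -- which its degree exhausts.
    corner-vertex : ∀ {p q c} → # (side p) (side q) ≤ 1 → boundary p q ≤ 5 → Cell (side p) (side q) c →
                    ∀ {z} → Boundary p q z → Adj c z
    corner-vertex {p} {q} {c} ≤1 ≤5 cc = five-neighbours (boundary? p q) c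
      (λ a → case exit cc a of λ
        { (inj₁ d) → ⊥-elim (adj-irrefl (subst (Adj c) (count-≤-1 (cell? _ _) ≤1 d cc) a)) ; (inj₂ b) → b })
      (≤-trans (count-boundary p q) ≤5)

    corner-good : ∀ p q → 2 ≤ # (side p) (side q) → boundary p q ≤ 5 →
                  ∃ λ ρ → Good ρ × size ρ (side true) ≤ # (side p) (side q)
    corner-good p q 2≤ ≤5 = region , good , count-mono (at region (side true)) (cell? _ _) (proj₁ ∘ region-true⁻)
      where
      open Region (cell? (side p) (side q)) (boundary? p q)
      good : Good region
      good = region-good (≤-trans (count-boundary p q) ≤5)
        (≤-trans 2≤ (count-mono (cell? _ _) _ (λ c → c , λ b → boundary-disjoint b c)))
        -- The other side of the new separation contains all of side `not p` of `σ`.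
        (≤-trans (gσ .size-side (not p)) (count-mono (at σ (side (not p))) _
          (λ e → (λ (f , _) → opposed f e) , λ { (inj₁ (f , _)) → opposed f e
                                               ; (inj₂ (inj₁ (c , _))) → clash c e
                                               ; (inj₂ (inj₂ (c , _))) → clash c e })))
        (λ c _ → exit c)

module EveryEdgeSeparated {N} (Adj : Fin N → Fin N → Set) (adj? : ∀ u v → Dec (Adj u v))
  (adj-sym : ∀ {u v} → Adj u v → Adj v u) (adj-irrefl : ∀ {u} → ¬ Adj u u)
  (5<N : 5 < N)
  (five-connected : FiveConnected Adj)
  (covered : ∀ {x y} → Adj x y → ∃ λ σ →
     Separations.Good Adj adj? adj-sym adj-irrefl 5<N five-connected σ × σ x ≡ cut × σ y ≡ cut)
  where

  open Separations Adj adj? adj-sym adj-irrefl 5<N five-connected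
  open Good

  cut-or-side : (x : Place) → x ≡ cut ⊎ ∃ λ q → x ≡ side q
  cut-or-side cut      = inj₁ refl
  cut-or-side (side q) = inj₂ (q , refl)

  adj⇒≢ : ∀ {u v} → Adj u v → u ≢ v
  adj⇒≢ a refl = adj-irrefl a

  -- A smallest side with at least three vertices

  module LargeFragment {σ} (gσ : Good σ) p
    (minimal : ∀ {τ} → Good τ → ∀ q → size σ (side p) ≤ size τ (side q))
    (3≤A : 3 ≤ size σ (side p)) where

    A T : Pred V 0ℓ
    A v = σ v ≡ side p
    T v = σ v ≡ cut

    module Meet {τ} (gτ : Good τ) {x} (x∈A : A x) (x∈τ : τ x ≡ cut) where
      open Crossing gσ gτ

      abstract
        -- Otherwise the corner would be a side of a good separation, and a smaller one than A,
        -- since `x` is in A but not in the corner.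
        no-smaller : ∀ q → # (side p) (side q) ≤ 1 ⊎ 6 ≤ boundary p q
        no-smaller q with # (side p) (side q) ≤? 1 | 6 ≤? boundary p q
        ... | yes ≤1 | _      = inj₁ ≤1
        ... | no _   | yes 6≤ = inj₂ 6≤
        ... | no ≰1  | no 6≰  = let ρ , gρ , ≤ll = corner-good p q (≰⇒> ≰1) (≤-pred (≰⇒> 6≰)) in
          ⊥-elim (<⇒≱ (≤-trans (+-mono-≤ (some-≤-count (cell? (side p) cut) (x∈A , x∈τ)) ≤ll)
            (count-mono-⊎ (at σ (side p)) (cell? (side p) cut) (cell? (side p) (side q)) proj₁ proj₁
              (λ (_ , c) (_ , e) → clash c e))) (minimal gρ true))

        shape : ∀ q → # (side p) cut ≤ 2 × # (side p) (side q) ≤ 1 × (1 ≤ # (side p) (side q) → boundary p q ≤ 5) ×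
                      (1 ≤ # (side p) (side q) → # (side p) (side (not q)) ≤ 0 → 2 ≤ # cut (side (not q)))
        shape q = fragment-arith (cells p q) (τ-cut p) (σ-cut q)
          (some-≤-count (cell? (side p) cut) (x∈A , x∈τ))
          (subst (3 ≤_) (sym (row (side p) q)) 3≤A)
          (subst₂ _≤_ (sym (row (side p) q)) (sym (row (side (not p)) q)) (minimal gσ (not p)))
          (subst₂ _≤_ (sym (row (side p) q)) (sym (column (side q) p)) (minimal gτ q))
          (subst₂ _≤_ (sym (row (side p) q)) (sym (column (side (not q)) p)) (minimal gτ (not q)))
          (no-smaller q) (no-smaller (not q))
          (corner₀ (not p) (not q)) (corner₀ (not p) q) (corner₀ p q) (corner₀ p (not q))

        at-most-two : ∀ {u v w} → A u → A v → A w → τ u ≡ cut → τ v ≡ cut → τ w ≡ cut → u ≢ v → w ≡ u ⊎ w ≡ v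
        at-most-two u∈A v∈A w∈A u∈τ v∈τ w∈τ = count-≤-2 (cell? (side p) cut) (proj₁ (shape true)) (u∈A , u∈τ) (v∈A , v∈τ) (w∈A , w∈τ)

        outsider : ∃ λ c → A c × τ c ≢ cut
        outsider = witness (λ c → at σ (side p) c ×-dec ¬? (at τ cut c)) (+-cancelˡ-≤ 2 _ _ (begin
          3                                                          ≤⟨ 3≤A ⟩
          size σ (side p)                                            ≤⟨ count-mono-+ _ (cell? (side p) cut) _ divide ⟩
          # (side p) cut + count (λ c → at σ (side p) c ×-dec ¬? (at τ cut c)) ≤⟨ +-monoˡ-≤ _ (proj₁ (shape true)) ⟩
          2 + count (λ c → at σ (side p) c ×-dec ¬? (at τ cut c))    ∎))
          where
          open ≤-Reasoning
          divide : ∀ {v} → A v → Cell (side p) cut v ⊎ A v × τ v ≢ cut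
          divide {v} a with at τ cut v
          ... | yes c = inj₁ (a , c)
          ... | no ¬c = inj₂ (a , ¬c)

        joined : ∀ {c q} → Cell (side p) (side q) c → ∀ {z} → A z ⊎ T z → τ z ≡ cut → Adj c z
        joined {c} {q} cc z∈ z∈τ = corner-vertex (proj₁ (proj₂ (shape q)))
          (proj₁ (proj₂ (proj₂ (shape q))) (some-≤-count (cell? (side p) (side q)) cc)) cc
          ([ (λ a → inj₁ (a , z∈τ)) , (λ t → inj₂ (inj₁ (t , z∈τ))) ]′ z∈)

        outsider-joined : ∀ {c z} → A c → τ c ≢ cut → A z ⊎ T z → τ z ≡ cut → Adj c z
        outsider-joined {c} a ≢cut z∈ z∈τ with cut-or-side (τ c)
        ... | inj₁ e       = ⊥-elim (≢cut e)
        ... | inj₂ (q , e) = joined (a , e) z∈ z∈τ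

        outsiders-independent : ∀ {c d} → A c → A d → τ c ≢ cut → τ d ≢ cut → c ≢ d → ¬ Adj c d
        outsiders-independent {c} {d} a b ≢c ≢d c≢d adj with cut-or-side (τ c)
        ... | inj₁ e       = ≢c e
        ... | inj₂ (q , e) with apart gτ e adj
        ...   | inj₁ e′ = c≢d (count-≤-1 (cell? (side p) (side q)) (proj₁ (proj₂ (shape q))) (a , e) (b , e′))
        ...   | inj₂ e′ = ≢d e′

    abstract
      -- Take a separation through an edge from `t` to some `x` in A. The vertices of A outside its
      -- separator are joined to `t`, and of the at most two inside, one is `x`.
      few-non-neighbours : ∀ {t y z} → T t → A y → A z → ¬ Adj y t → ¬ Adj z t → y ≡ z
      few-non-neighbours {t} {y} {z} t∈ y∈ z∈ ¬yt ¬zt with cut-meets-side gσ p t∈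
      ... | x , x∈ , tx with covered tx
      ...   | τ , gτ , t∈τ , x∈τ = conclude (in-cut y∈ ¬yt) (in-cut z∈ ¬zt)
        where
        in-cut : ∀ {w} → A w → ¬ Adj w t → τ w ≡ cut
        in-cut {w} w∈ ¬wt = decidable-stable (at τ cut w) λ w∉τ →
          ¬wt (Meet.outsider-joined gτ x∈ x∈τ w∈ w∉τ (inj₂ t∈) t∈τ)
        conclude : τ y ≡ cut → τ z ≡ cut → y ≡ z
        conclude y∈τ z∈τ with Meet.at-most-two gτ x∈ x∈τ x∈ y∈ z∈ x∈τ y∈τ z∈τ (λ { refl → ¬yt (adj-sym tx) })
        ... | inj₁ refl = ⊥-elim (¬zt (adj-sym tx))
        ... | inj₂ refl = refl

    non-neighbour? : ∀ s → Decidable (λ t → T t × ¬ Adj s t)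
    non-neighbour? s t = at σ cut t ×-dec ¬? (adj? s t)

    abstract
      -- The separator through the edge `uv` leaves `s` alone in its corner and the other corner in
      -- A empty, so by `shape` two vertices of T lie across from `s`.
      many-non-neighbours : ∀ {u v s} → A u → A v → A s → Adj u v → s ≢ u → s ≢ v →
                            (∀ {d} → A d → d ≡ u ⊎ d ≡ v ⊎ d ≡ s) → 2 ≤ count (non-neighbour? s)
      many-non-neighbours {u} {v} {s} u∈ v∈ s∈ uv s≢u s≢v all with covered uv
      ... | τ , gτ , u∈τ , v∈τ with cut-or-side (τ s)
      ...   | inj₁ s∈τ = ⊥-elim ([ s≢u , s≢v ]′ (Meet.at-most-two gτ u∈ u∈τ u∈ v∈ s∈ u∈τ v∈τ s∈τ (λ { refl → adj-irrefl uv })))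
      ...   | inj₂ (q , e) = ≤-trans
        (proj₂ (proj₂ (proj₂ (shape q))) (some-≤-count (cell? _ _) (s∈ , e))
          (subst (# (side p) (side (not q)) ≤_) (count-none {N}) (count-mono (cell? _ _) none? empty)))
        (count-mono (cell? _ _) (non-neighbour? s) λ (t∈ , t-far) → t∈ , λ st →
          case apart gτ e st of λ { (inj₁ near) → opposed near t-far ; (inj₂ c) → clash c t-far })
        where
        open Meet gτ u∈ u∈τ
        open Crossing gσ gτ
        empty : ∀ {d} → ¬ Cell (side p) (side (not q)) d
        empty (d∈ , far) with all d∈
        ... | inj₁ refl        = clash u∈τ far
        ... | inj₂ (inj₁ refl) = clash v∈τ far
        ... | inj₂ (inj₂ refl) = opposed e far

      -- Vertices of A outside a separator are joined to its vertices in A. Applied to an edge at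
      -- `x` this yields `c`, and applied to the edge `cx` it yields `q`.
      triangle : ∃ λ c → ∃ λ x → ∃ λ q → A c × A x × A q × Adj c x × Adj q c × Adj q x ×
                 (∀ {d} → A d → d ≡ c ⊎ d ≡ x ⊎ d ≡ q)
      triangle with witness (at σ (side p)) (≤-trans (s≤s z≤n) 3≤A)
      ... | x , x∈ with witness (adj? x) (≤-trans (s≤s z≤n) (degree x))
      ...   | y , xy with covered xy
      ...     | τ , gτ , x∈τ , y∈τ with Meet.outsider gτ x∈ x∈τ
      ...       | c , c∈ , c∉τ with Meet.outsider-joined gτ x∈ x∈τ c∈ c∉τ (inj₁ x∈) x∈τ
      ...         | cx with covered cx
      ...           | ρ , gρ , c∈ρ , x∈ρ with Meet.outsider gρ c∈ c∈ρ
      ...             | q , q∈ , q∉ρ =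
        let qc = Meet.outsider-joined gρ c∈ c∈ρ q∈ q∉ρ (inj₁ c∈) c∈ρ
            qx = Meet.outsider-joined gρ c∈ c∈ρ q∈ q∉ρ (inj₁ x∈) x∈ρ
        in c , x , q , c∈ , x∈ , q∈ , cx , qc , qx , all c∈ x∈ q∈ cx qc qx gρ c∈ρ x∈ρ q∉ρ
        where
        all : ∀ {c x q} → A c → A x → A q → Adj c x → Adj q c → Adj q x → ∀ {ρ} → Good ρ →
              ρ c ≡ cut → ρ x ≡ cut → ρ q ≢ cut → ∀ {d} → A d → d ≡ c ⊎ d ≡ x ⊎ d ≡ q
        all {c} {x} {q} c∈ x∈ q∈ cx qc qx {ρ} gρ c∈ρ x∈ρ q∉ρ {d} d∈ with at ρ cut d
        ... | yes d∈ρ = Sum.map₂ inj₁ (Meet.at-most-two gρ c∈ c∈ρ c∈ x∈ d∈ c∈ρ x∈ρ d∈ρ (λ { refl → adj-irrefl cx }))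
        ... | no d∉ρ with d Fin.≟ q
        ...   | yes d≡q = inj₂ (inj₂ d≡q)
        -- A separator through a fourth vertex `d` and `c` has no room for `x` or `q`. Both would be
        -- outsiders, which are never adjacent, but `qx` is an edge.
        ...   | no d≢q  with covered (Meet.outsider-joined gρ c∈ c∈ρ d∈ d∉ρ (inj₁ c∈) c∈ρ)
        ...     | π , gπ , d∈π , c∈π with at π cut x | at π cut q
        ...       | no x∉π  | no q∉π  = ⊥-elim (outsiders-independent q∈ x∈ q∉π x∉π (λ { refl → adj-irrefl qx }) qx)
          where open Meet gπ c∈ c∈π
        ...       | yes x∈π | _ = ⊥-elim (case Meet.at-most-two gπ c∈ c∈π c∈ d∈ x∈ c∈π d∈π x∈π (λ { refl → d∉ρ c∈ρ }) of λ
          { (inj₁ refl) → adj-irrefl cx ; (inj₂ refl) → d∉ρ x∈ρ })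
        ...       | no _ | yes q∈π = ⊥-elim (case Meet.at-most-two gπ c∈ c∈π c∈ d∈ q∈ c∈π d∈π q∈π (λ { refl → d∉ρ c∈ρ }) of λ
          { (inj₁ refl) → adj-irrefl qc ; (inj₂ refl) → d≢q refl })

      disjoint : ∀ {y z} → A y → A z → y ≢ z → ∀ {t} → T t × ¬ Adj y t → ¬ (T t × ¬ Adj z t)
      disjoint y∈ z∈ y≢z (t∈ , ¬yt) (_ , ¬zt) = y≢z (few-non-neighbours t∈ y∈ z∈ ¬yt ¬zt)

      crowded : ∀ {c x q} → A c → A x → A q → c ≢ x → c ≢ q → x ≢ q →
                count (non-neighbour? c) + count (non-neighbour? x) + count (non-neighbour? q) ≤ 5
      crowded {c} {x} {q} c∈ x∈ q∈ c≢x c≢q x≢q = ≤-trans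
        (count-mono-⊎₃ (at σ cut) (non-neighbour? c) (non-neighbour? x) (non-neighbour? q) proj₁ proj₁ proj₁
          (disjoint c∈ x∈ c≢x) (disjoint c∈ q∈ c≢q) (disjoint x∈ q∈ x≢q))
        (≤-reflexive (size-cut gσ))

      -- Each vertex of the triangle A misses two vertices of T, and no vertex of T is missed twice.
      six : ∀ {c x q} → A c → A x → A q → Adj c x → Adj q c → Adj q x → (∀ {d} → A d → d ≡ c ⊎ d ≡ x ⊎ d ≡ q) →
            2 + 2 + 2 ≤ count (non-neighbour? c) + count (non-neighbour? x) + count (non-neighbour? q)
      six {c} {x} {q} c∈ x∈ q∈ cx qc qx all = +-mono-≤ (+-mono-≤
          (many-non-neighbours x∈ q∈ c∈ (adj-sym qx) (adj⇒≢ cx) (≢-sym (adj⇒≢ qc)) all-c)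
          (many-non-neighbours c∈ q∈ x∈ (adj-sym qc) (≢-sym (adj⇒≢ cx)) (≢-sym (adj⇒≢ qx)) all-x))
          (many-non-neighbours c∈ x∈ q∈ cx (adj⇒≢ qc) (adj⇒≢ qx) all)
        where
        all-c : ∀ {d} → A d → d ≡ x ⊎ d ≡ q ⊎ d ≡ c
        all-c d∈ = [ inj₂ ∘ inj₂ , Sum.map₂ inj₁ ]′ (all d∈)
        all-x : ∀ {d} → A d → d ≡ c ⊎ d ≡ q ⊎ d ≡ x
        all-x d∈ = Sum.map₂ Sum.swap (all d∈)

    impossible : ⊥
    impossible with triangle
    ... | c , x , q , c∈ , x∈ , q∈ , cx , qc , qx , all = <⇒≱ (six c∈ x∈ q∈ cx qc qx all)
      (crowded c∈ x∈ q∈ (adj⇒≢ cx) (≢-sym (adj⇒≢ qc)) (≢-sym (adj⇒≢ qx)))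

  -- A side with two vertices, and separators containing just one of them

  record TwoFragment (σ : V → Place) (p : Bool) (a b : V) : Set where
    field
      good : Good σ
      a∈   : σ a ≡ side p
      b∈   : σ b ≡ side p
      a≢b  : a ≢ b
      only : ∀ {v} → σ v ≡ side p → v ≡ a ⊎ v ≡ b

    size-2 : size σ (side p) ≡ 2
    size-2 = ≤-antisym
      (≤-trans (count-mono-+ (at σ (side p)) (Fin._≟ a) (Fin._≟ b) only)
               (≤-reflexive (cong₂ _+_ (count-≟ a) (count-≟ b))))
      (good .size-side p)

    near-a : ∀ {v} → Adj a v → v ≡ b ⊎ σ v ≡ cut
    near-a av with apart good a∈ av
    ... | inj₂ c = inj₂ c
    ... | inj₁ e with only e
    ...   | inj₁ refl = ⊥-elim (adj-irrefl av)
    ...   | inj₂ v≡b  = inj₁ v≡b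

    attached : ∀ {t} → σ t ≡ cut → Adj a t ⊎ Adj b t
    attached t∈ with cut-meets-side good p t∈
    ... | v , v∈ , tv with only v∈
    ...   | inj₁ refl = inj₁ (adj-sym tv)
    ...   | inj₂ refl = inj₂ (adj-sym tv)

  swapped : ∀ {σ p a b} → TwoFragment σ p a b → TwoFragment σ p b a
  swapped F = record { good = good ; a∈ = b∈ ; b∈ = a∈ ; a≢b = ≢-sym a≢b ; only = Sum.swap ∘ only }
    where open TwoFragment F

  module Halved {σ p a b} (F : TwoFragment σ p a b) where
    open TwoFragment F

    record Private (x : V) : Set where
      field
        x∈T       : σ x ≡ cut
        a~x       : Adj a x
        b≁x       : ¬ Adj b x
        b~others  : ∀ {z} → z ≡ a ⊎ σ z ≡ cut → z ≢ x → Adj b z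

    module _ {τ} (gτ : Good τ) (a∈τ : τ a ≡ cut) {q} (b∈q : τ b ≡ side q) where
      open Crossing good gτ

      abstract
        counts : # (side p) (side q) ≤ 1 × # cut (side (not q)) ≡ 1 × boundary p q ≤ 5
        counts = halved-arith (cells p q) (τ-cut p) (σ-cut q) (trans (row (side p) q) size-2)
          (some-≤-count (cell? (side p) cut) (a∈ , a∈τ))
          (some-≤-count (cell? (side p) (side q)) (b∈ , b∈q))
          (subst (2 ≤_) (sym (column (side (not q)) p)) (gτ .size-side (not q)))
          (corner₀ p q) (corner₀ (not p) (not q))

        joined-b : ∀ {z} → Boundary p q z → Adj b z
        joined-b = corner-vertex (proj₁ counts) (proj₂ (proj₂ counts)) (b∈ , b∈q)

        far-neighbour : ∃ (Cell cut (side (not q)))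
        far-neighbour = witness (cell? cut (side (not q))) (≤-reflexive (sym (proj₁ (proj₂ counts))))

        far-unique : ∀ {t u} → Cell cut (side (not q)) t → Cell cut (side (not q)) u → t ≡ u
        far-unique = count-≤-1 (cell? cut (side (not q))) (≤-reflexive (proj₁ (proj₂ counts)))

        far-apart : ∀ {x} → τ x ≡ side (not q) → ¬ Adj b x
        far-apart far bx with apart gτ b∈q bx
        ... | inj₁ near = opposed near far
        ... | inj₂ c    = clash c far

      -- The vertex `b` is alone in its corner, with a boundary of five. That boundary consists of
      -- `a` and all of T except the one vertex beyond the separator.
      far-private : ∀ {x} → Cell cut (side (not q)) x → Private x
      far-private {x} (x∈T , far) = record
        { x∈T = x∈T
        ; a~x = [ id , (λ bx → ⊥-elim (far-apart far bx)) ]′ (attached x∈T)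
        ; b≁x = far-apart far
        ; b~others = others
        }
        where
        others : ∀ {z} → z ≡ a ⊎ σ z ≡ cut → z ≢ x → Adj b z
        others (inj₁ refl) _ = joined-b (inj₁ (a∈ , a∈τ))
        others {z} (inj₂ z∈T) z≢x with place-cases q (τ z)
        ... | inj₁ near        = joined-b (inj₂ (inj₂ (z∈T , near)))
        ... | inj₂ (inj₁ c)    = joined-b (inj₂ (inj₁ (z∈T , c)))
        ... | inj₂ (inj₂ far′) = ⊥-elim (z≢x (far-unique (z∈T , far′) (x∈T , far)))

  -- Separators containing both vertices of the side

  module Split {σ p a b} (F : TwoFragment σ p a b) where
    open TwoFragment F

    T : Pred V 0ℓ
    T v = σ v ≡ cut

    record Splitting (τ : V → Place) (t : V) : Set where
      field
        τ-good : Good τ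
        a-cut  : τ a ≡ cut
        b-cut  : τ b ≡ cut
        t-cut  : τ t ≡ cut

    open Splitting

    module _ {τ t} (t∈T : T t) (S : Splitting τ t) where
      open Crossing good (S .τ-good)

      abstract
        halves : ∀ q → # cut cut ≤ 1 × # cut (side q) ≡ 2
        halves q = split-arith (cells p q) (τ-cut p) (σ-cut q) (trans (row (side p) q) size-2)
          (unique-≤-count (cell? (side p) cut) ((a≢b ∷ []) ∷ [] ∷ []) ((a∈ , S .a-cut) ∷ (b∈ , S .b-cut) ∷ []))
          (some-≤-count (cell? cut cut) (t∈T , S .t-cut))
          (subst (2 ≤_) (sym (column (side q) p)) (S .τ-good .size-side q))
          (subst (2 ≤_) (sym (column (side (not q)) p)) (S .τ-good .size-side (not q)))
          (corner₀ (not p) q) (corner₀ (not p) (not q))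

        only-t : ∀ {u} → T u → τ u ≡ cut → u ≡ t
        only-t u∈T u∈τ = count-≤-1 (cell? cut cut) (proj₁ (halves true)) (u∈T , u∈τ) (t∈T , S .t-cut)

        placed : ∀ {u} → T u → u ≢ t → ∃ λ q → τ u ≡ side q
        placed {u} u∈T u≢t with cut-or-side (τ u)
        ... | inj₁ c = ⊥-elim (u≢t (only-t u∈T c))
        ... | inj₂ e = e

        other : ∀ q v → ∃ λ k → T k × τ k ≡ side q × k ≢ v
        other q v with witness₂ (cell? cut (side q)) (≤-reflexive (sym (proj₂ (halves q))))
        ... | j , k , (j∈T , j∈q) , (k∈T , k∈q) , k≢j with j Fin.≟ v
        ...   | yes refl = k , k∈T , k∈q , k≢j
        ...   | no j≢v   = j , j∈T , j∈q , j≢v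

        third : ∀ {q j k l} → T j → τ j ≡ side q → T k → τ k ≡ side q → T l → τ l ≡ side q →
                j ≢ k → l ≡ j ⊎ l ≡ k
        third {q} j j∈ k k∈ l l∈ = count-≤-2 (cell? cut (side q)) (≤-reflexive (proj₂ (halves q))) (j , j∈) (k , k∈) (l , l∈)

    module Two {τ ω i j} (i∈T : T i) (j∈T : T j) (S : Splitting τ i) (R : Splitting ω j) where
      open Crossing (S .τ-good) (R .τ-good) public

      AB : Pred V 0ℓ
      AB v = v ≡ a ⊎ v ≡ b

      ab? : Decidable AB
      ab? v = v Fin.≟ a ⊎-dec v Fin.≟ b

      abstract
        count-ab : 2 ≤ count ab?
        count-ab = unique-≤-count ab? ((a≢b ∷ []) ∷ [] ∷ []) (inj₁ refl ∷ inj₂ refl ∷ [])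

        ab-cut : ∀ {v} → AB v → Cell cut cut v
        ab-cut (inj₁ refl) = S .a-cut , R .a-cut
        ab-cut (inj₂ refl) = S .b-cut , R .b-cut

        ab-near : ∀ {x y u v} → Cell (side x) (side y) u → AB v → Adj u v → T u
        ab-near (ux , _) (inj₁ refl) uv with near-a (adj-sym uv)
        ... | inj₁ refl = clash (S .b-cut) ux
        ... | inj₂ u∈T  = u∈T
        ab-near (ux , _) (inj₂ refl) uv with TwoFragment.near-a (swapped F) (adj-sym uv)
        ... | inj₁ refl = clash (S .a-cut) ux
        ... | inj₂ u∈T  = u∈T

        -- All neighbours of `a` and `b` other than each other are in T, so both can be left out of
        -- the boundary of a corner that misses T.
        avoiding-T : ∀ x y → (∀ {t} → T t → ¬ Cell (side x) (side y) t) →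
                     # (side x) (side y) ≤ 0 ⊎ 7 ≤ boundary x y
        avoiding-T x y none = Sum.map₂ (≤-trans (+-monoʳ-≤ 5 count-ab))
          (whole-corner x y ab? ab-cut (λ u∈ v∈ uv → none (ab-near u∈ v∈ uv) u∈))

        -- Since a and b have no neighbours in the corner apart from k, removing k from a larger
        -- corner would leave a set with only four neighbours.
        lonely : ∀ x y {k} → Cell (side x) (side y) k → (∀ {t} → T t → Cell (side x) (side y) t → t ≡ k) →
                 ∃ (Cell (side (not x)) (side (not y))) → # (side x) (side y) ≤ 1 × boundary x y ≤ 5
        lonely x y {k} k∈ only-k (l , l∈) = decidable-stable (_ ≤? 1) (λ ≰1 → big (≰⇒> ≰1)) , tight
          where
          tight : boundary x y ≤ 5
          tight = opposite-arith (cells x y) (τ-cut x) (σ-cut y) (occupied l∈)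
          big : 2 ≤ # (side x) (side y) → ⊥
          big 2≤ = n≮n 6 (≤-trans (+-monoʳ-≤ 5 count-ab) (≤-trans (part-of-corner x y X? ab? proj₁ nonempty-X ab-cut no-edge)
            (+-mono-≤ tight rest≤1)))
            where
            X? : Decidable (λ v → Cell (side x) (side y) v × v ≢ k)
            X? = cell? (side x) (side y) without k
            nonempty-X : ∃ (λ v → Cell (side x) (side y) v × v ≢ k)
            nonempty-X = witness X? (≤-pred (≤-trans 2≤ (count-without (cell? (side x) (side y)) k)))
            no-edge : ∀ {u v} → Cell (side x) (side y) u × u ≢ k → AB v → ¬ Adj u v
            no-edge (u∈ , u≢k) v∈ uv = u≢k (only-k (ab-near u∈ v∈ uv) u∈)
            rest≤1 : count (corner-rest? x y X? ab? proj₁ nonempty-X ab-cut no-edge) ≤ 1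
            rest≤1 = count-all-but (corner-rest? x y X? ab? proj₁ nonempty-X ab-cut no-edge) k
              λ {v} (v∈ , v∉X) → decidable-stable (v Fin.≟ k) λ v≢k → v∉X (v∈ , v≢k)

    module Exchange {τ ω i j} (i∈T : T i) (j∈T : T j) (S : Splitting τ i) (R : Splitting ω j)
      {k x y} (j∈x : τ j ≡ side x) (k∈T : T k) (k∈x : τ k ≡ side x) (k≢j : k ≢ j) (k∈y : ω k ≡ side y) where
      open Two i∈T j∈T S R

      abstract
        on-x : ∀ {t} → T t → τ t ≡ side x → t ≡ j ⊎ t ≡ k
        on-x t∈T t∈x = third i∈T S j∈T j∈x k∈T k∈x t∈T t∈x (≢-sym k≢j)

        only-k : ∀ {t} → T t → Cell (side x) (side y) t → t ≡ k
        only-k t∈T (t∈x , t∈y) with on-x t∈T t∈x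
        ... | inj₁ refl = clash (R .t-cut) t∈y
        ... | inj₂ t≡k  = t≡k

        -- One of the two vertices of T on side `not y` of `ω` is not `i`. It avoids the separator
        -- of `τ`, which meets T in `i` only, and side `x`, where T has just `j` and `k`.
        opposite : ∃ (Cell (side (not x)) (side (not y)))
        opposite with other j∈T R (not y) i
        ... | l , l∈T , l∉y , l≢i with place-cases x (τ l)
        ...   | inj₂ (inj₂ l∉x) = l , l∉x , l∉y
        ...   | inj₂ (inj₁ c)   = ⊥-elim (l≢i (only-t i∈T S l∈T c))
        ...   | inj₁ l∈x with on-x l∈T l∈x
        ...     | inj₁ refl = clash (R .t-cut) l∉y
        ...     | inj₂ refl = opposed k∈y l∉y

        alone : # (side x) (side y) ≤ 1 × boundary x y ≤ 5
        alone = lonely x y (k∈x , k∈y) only-k opposite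

        k~boundary : ∀ {z} → Boundary x y z → Adj k z
        k~boundary = corner-vertex (proj₁ alone) (proj₂ alone) (k∈x , k∈y)

        k~j : Adj k j
        k~j = k~boundary (inj₁ (j∈x , R .t-cut))

        k~i : ω i ≡ side y → Adj k i
        k~i i∈y = k~boundary (inj₂ (inj₂ (S .t-cut , i∈y)))

        k-near : ∀ {t} → T t → Adj k t → t ≡ i ⊎ t ≡ j
        k-near t∈T kt with exit (k∈x , k∈y) kt
        ... | inj₁ t∈                      = ⊥-elim (adj⇒≢ kt (sym (only-k t∈T t∈)))
        ... | inj₂ (inj₁ (_ , c))          = inj₂ (only-t j∈T R t∈T c)
        ... | inj₂ (inj₂ (inj₁ (c , _)))   = inj₁ (only-t i∈T S t∈T c)
        ... | inj₂ (inj₂ (inj₂ (c , _)))   = inj₁ (only-t i∈T S t∈T c)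

    module AllSplit (all : ∀ {t} → T t → ∃ λ τ → Splitting τ t) where

      abstract
        -- If the separator of i pairs k with j, then that of j must pair k with i, for otherwise k would
        -- have a neighbour in T besides i and j.
        star : ∀ {τ i} → T i → Splitting τ i → ∀ {j k x} → T j → τ j ≡ side x → T k → τ k ≡ side x → k ≢ j →
               Adj k i × (∀ {t} → T t → Adj i t → t ≡ j ⊎ t ≡ k)
        star {τ} {i} i∈T S {j} {k} j∈T j∈x k∈T k∈x k≢j with all j∈T | all k∈T
        ... | ω , R | π , Q with placed j∈T R k∈T k≢j
        ...   | y , k∈y with other j∈T R y k
        ...     | m , m∈T , m∈y , m≢k with placed k∈T Q m∈T m≢k
        ...       | z , m∈z with Exchange.k-near i∈T j∈T S R j∈x k∈T k∈x k≢j k∈y m∈T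
                                   (adj-sym (Exchange.k~j j∈T k∈T R Q k∈y m∈T m∈y m≢k m∈z))
        ...         | inj₂ refl = clash (R .t-cut) m∈y
        ...         | inj₁ refl = Exchange.k~i i∈T j∈T S R j∈x k∈T k∈x k≢j k∈y m∈y
                                , Exchange.k-near j∈T k∈T R Q k∈y m∈T m∈y m≢k m∈z

      -- The separator of `i` pairs the rest of T as {j, k} and {m, l}. By `star`, the second pair
      -- makes `l` a neighbour of `i`, while the first allows `i` no neighbours in T besides `j` and
      -- `k`.
      absurd : ⊥
      absurd with witness (at σ cut) (≤-trans (s≤s z≤n) (≤-reflexive (sym (good .size-cut))))
      ... | i , i∈T with all i∈T
      ...   | τ , S with other i∈T S true i | other i∈T S false i
      ...     | j , j∈T , j∈x , _ | m , m∈T , m∉x , _ with other i∈T S true j | other i∈T S false m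
      ...       | k , k∈T , k∈x , k≢j | l , l∈T , l∉x , l≢m
        with proj₂ (star i∈T S j∈T j∈x k∈T k∈x k≢j) l∈T (adj-sym (proj₁ (star i∈T S m∈T m∉x l∈T l∉x l≢m)))
      ...         | inj₁ refl = opposed j∈x l∉x
      ...         | inj₂ refl = opposed k∈x l∉x

    open Halved F

    -- If `a` is adjacent to `t`, the hypothesis puts `b` into the separator through `a` and `t`. If
    -- not, a separator through `b` and `t` must contain `a`: otherwise `a` would be joined to every
    -- vertex of T but one private to `b`, and in particular to `t`.
    separator-halving : ¬ (∀ {τ} → Good τ → τ a ≡ cut → τ b ≡ cut)
    separator-halving both = AllSplit.absurd split
      where
      via-b : ∀ {t} → T t → ¬ Adj a t → Adj b t → ∃ λ τ → Splitting τ t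
      via-b t∈T ¬at bt with covered bt
      ... | τ , gτ , b∈τ , t∈τ with cut-or-side (τ a)
      ...   | inj₁ a∈τ = τ , record { τ-good = gτ ; a-cut = a∈τ ; b-cut = b∈τ ; t-cut = t∈τ }
      ...   | inj₂ (q , a∈q) with Halved.far-neighbour (swapped F) gτ b∈τ a∈q
      ...     | x , x∈ = ⊥-elim (¬at (Halved.Private.b~others (Halved.far-private (swapped F) gτ b∈τ a∈q x∈)
                           (inj₂ t∈T) λ { refl → clash t∈τ (proj₂ x∈) }))
      split : ∀ {t} → T t → ∃ λ τ → Splitting τ t
      split {t} t∈T with adj? a t
      ... | yes at with covered at
      ...   | τ , gτ , a∈τ , t∈τ = τ , record { τ-good = gτ ; a-cut = a∈τ ; b-cut = both gτ a∈τ ; t-cut = t∈τ }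
      split {t} t∈T | no ¬at with attached t∈T
      ... | inj₁ at = ⊥-elim (¬at at)
      ... | inj₂ bt = via-b t∈T ¬at bt

    -- The companion of a private neighbour

    -- What the endgame needs of a separation `υ` with `a` but not `b` in its separator: {x, s} is
    -- its side away from `b`, and `s` is joined to `x` and to the separator except `a`.
    record Tip (x : V) : Set where
      field
        τ υ     : V → Place
        S       : Splitting τ x
        s       : V
        s-cut   : τ s ≡ cut
        s≢x     : s ≢ x
        s≢a     : s ≢ a
        s≢b     : s ≢ b
        s~x     : Adj s x
        s-near  : ∀ {v} → Adj s v → v ≡ x ⊎ υ v ≡ cut
        s~υ     : ∀ {v} → υ v ≡ cut → v ≢ a → Adj s v
        x-near  : ∀ {v} → Adj x v → v ≡ s ⊎ υ v ≡ cut
        υ∩τ     : ∀ {v} → υ v ≡ cut → τ v ≡ cut → v ≡ a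

    module _ {υ} (gυ : Good υ) (a∈υ : υ a ≡ cut) {q} (b∈q : υ b ≡ side q)
             {x} (x∈T : T x) (x∉q : υ x ≡ side (not q)) {τ} (S : Splitting τ x) where
      open Crossing gυ (S .τ-good)

      abstract
        -- A neighbour of `a` is `b`, which is on the other side of `υ`, or in T, whose only vertex
        -- on this side is `x`; but `x` is in the separator of `τ`.
        a-avoids : ∀ r {u v} → Cell (side (not q)) (side r) u → v ≡ a → ¬ Adj u v
        a-avoids r (u∉q , u∈r) refl ua with near-a (adj-sym ua)
        ... | inj₁ refl = opposed b∈q u∉q
        ... | inj₂ u∈T  = clash (S .t-cut) (subst (λ w → τ w ≡ side r) (far-unique gυ a∈υ b∈q (u∈T , u∉q) (x∈T , x∉q)) u∈r)

        avoid-a : ∀ r → # (side (not q)) (side r) ≤ 0 ⊎ 6 ≤ boundary (not q) r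
        avoid-a r = Sum.map₂ (subst (λ k → 5 + k ≤ _) (count-≟ a))
          (whole-corner (not q) r (Fin._≟ a) (λ { refl → a∈υ , S .a-cut }) (a-avoids r))

        tip-counts : # (side (not q)) (side true) ≤ 0 × # (side (not q)) (side false) ≤ 0 ×
                     # (side (not q)) cut ≡ 2 × # cut cut ≡ 1
        tip-counts = tip-arith (cells q true) (τ-cut q) (σ-cut true)
          (some-≤-count (cell? (side q) cut) (b∈q , S .b-cut))
          (some-≤-count (cell? cut cut) (a∈υ , S .a-cut))
          (unique-≤-count (cell? (side (not q)) cut) ([] ∷ []) ((x∉q , S .t-cut) ∷ []))
          (subst (2 ≤_) (sym (column (side true) q)) (S .τ-good .size-side true))
          (subst (2 ≤_) (sym (column (side false) q)) (S .τ-good .size-side false))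
          (subst (2 ≤_) (sym (row (side q) true)) (gυ .size-side q))
          (subst (2 ≤_) (sym (row (side (not q)) true)) (gυ .size-side (not q)))
          (avoid-a true) (avoid-a false) (corner₀ q true) (corner₀ q false)

        far-cut : ∀ {v} → υ v ≡ side (not q) → τ v ≡ cut
        far-cut {v} v∉q with place-cases true (τ v)
        ... | inj₂ (inj₁ c) = c
        ... | inj₁ e        = ⊥-elim (<⇒≱ (unique-≤-count (cell? (side (not q)) (side true)) ([] ∷ []) ((v∉q , e) ∷ [])) (proj₁ tip-counts))
        ... | inj₂ (inj₂ e) = ⊥-elim (<⇒≱ (unique-≤-count (cell? (side (not q)) (side false)) ([] ∷ []) ((v∉q , e) ∷ [])) (proj₁ (proj₂ tip-counts)))

        second : ∃ λ s → υ s ≡ side (not q) × s ≢ x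
        second with witness (cell? (side (not q)) cut without x) (≤-pred
          (≤-trans (≤-reflexive (sym (proj₁ (proj₂ (proj₂ tip-counts))))) (count-without (cell? (side (not q)) cut) x)))
        ... | s , (s∉q , _) , s≢x = s , s∉q , s≢x

        pair : ∀ {s} → υ s ≡ side (not q) → s ≢ x → ∀ {v} → υ v ≡ side (not q) → v ≡ x ⊎ v ≡ s
        pair s∉q s≢x v∉q = count-≤-2 (cell? (side (not q)) cut) (≤-reflexive (proj₁ (proj₂ (proj₂ tip-counts))))
          (x∉q , S .t-cut) (s∉q , far-cut s∉q) (v∉q , far-cut v∉q) (≢-sym s≢x)

      module _ {s} (s∉q : υ s ≡ side (not q)) (s≢x : s ≢ x) where

        -- The candidates for neighbours of `s`. Excluding `a` brings them down from six to five, so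
        -- that the degree of `s` makes all of them neighbours.
        Z : Pred V 0ℓ
        Z v = v ≡ x ⊎ (υ v ≡ cut × v ≢ a)

        z? : Decidable Z
        z? v = v Fin.≟ x ⊎-dec (at υ cut without a) v

        abstract
          s≁a : ¬ Adj s a
          s≁a sa with near-a (adj-sym sa)
          ... | inj₁ refl = opposed b∈q s∉q
          ... | inj₂ s∈T  = s≢x (far-unique gυ a∈υ b∈q (s∈T , s∉q) (x∈T , x∉q))

          N⊆Z : ∀ {v} → Adj s v → Z v
          N⊆Z sv with apart gυ s∉q sv
          ... | inj₂ c = inj₂ (c , λ { refl → s≁a sv })
          ... | inj₁ v∉q with pair s∉q s≢x v∉q
          ...   | inj₁ v≡x = inj₁ v≡x
          ...   | inj₂ v≡s = ⊥-elim (adj⇒≢ sv (sym v≡s))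

          Z≤5 : count z? ≤ 5
          Z≤5 = ≤-trans (count-mono-+ z? (Fin._≟ x) (at υ cut without a) id)
            (≤-trans (≤-reflexive (cong (_+ count (at υ cut without a)) (count-≟ x)))
              (≤-trans (without-count (at υ cut) a∈υ) (≤-reflexive (gυ .size-cut))))

          x-neighbours : ∀ {v} → Adj x v → v ≡ s ⊎ υ v ≡ cut
          x-neighbours xv with apart gυ x∉q xv
          ... | inj₂ c = inj₂ c
          ... | inj₁ v∉q with pair s∉q s≢x v∉q
          ...   | inj₁ v≡x = ⊥-elim (adj⇒≢ xv (sym v≡x))
          ...   | inj₂ v≡s = inj₁ v≡s

        tip-at : Tip x
        tip-at = record
          { τ = τ ; υ = υ ; S = S ; s = s
          ; s-cut = far-cut s∉q
          ; s≢x = s≢x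
          ; s≢a = λ { refl → clash a∈υ s∉q }
          ; s≢b = λ { refl → opposed b∈q s∉q }
          ; s~x = five-neighbours z? s N⊆Z Z≤5 (inj₁ refl)
          ; s-near = λ sv → Sum.map₂ proj₁ (N⊆Z sv)
          ; s~υ = λ v∈υ v≢a → five-neighbours z? s N⊆Z Z≤5 (inj₂ (v∈υ , v≢a))
          ; x-near = x-neighbours
          ; υ∩τ = λ v∈υ v∈τ → count-≤-1 (cell? cut cut) (≤-reflexive (proj₂ (proj₂ (proj₂ tip-counts)))) (v∈υ , v∈τ) (a∈υ , S .a-cut)
          }

    abstract
      -- A separator through `a` and `x` without `b` would have a vertex of T beyond it and make `b`
      -- adjacent to all of T except that vertex, hence to `x`.
      split-at-private : ∀ {x} → Private x → ∃ λ τ → Splitting τ x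
      split-at-private {x} P with covered (Private.a~x P)
      ... | τ , gτ , a∈τ , x∈τ with cut-or-side (τ b)
      ...   | inj₁ b∈τ = τ , record { τ-good = gτ ; a-cut = a∈τ ; b-cut = b∈τ ; t-cut = x∈τ }
      ...   | inj₂ (q , b∈q) with far-neighbour gτ a∈τ b∈q
      ...     | y , y∈ = ⊥-elim (Private.b≁x P (Private.b~others (far-private gτ a∈τ b∈q y∈)
                           (inj₂ (Private.x∈T P)) λ { refl → clash x∈τ (proj₂ y∈) }))

    tip : ∀ {υ} → Good υ → υ a ≡ cut → ∀ {q} → υ b ≡ side q → ∃ λ x → Private x × Tip x
    tip gυ a∈υ b∈q with far-neighbour gυ a∈υ b∈q
    ... | x , x∈T , x∉q with split-at-private (far-private gυ a∈υ b∈q (x∈T , x∉q))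
    ...   | τ , S with second gυ a∈υ b∈q x∈T x∉q S
    ...     | s , s∉q , s≢x = x , far-private gυ a∈υ b∈q (x∈T , x∉q) , tip-at gυ a∈υ b∈q x∈T x∉q S s∉q s≢x

  -- Crossing the separators of the two private neighbours

  module Endgame {σ p a b} (F : TwoFragment σ p a b) {x y}
    (X : Halved.Private F x) (Y : Halved.Private (swapped F) y)
    (tip-x : Split.Tip F x) (tip-y : Split.Tip (swapped F) y) where
    open TwoFragment F
    open Halved.Private X renaming (b~others to b~)
    open Halved.Private Y using () renaming (x∈T to y∈T; a~x to b~y; b≁x to a≁y)
    open Split F
    open Tip tip-x
    open Splitting S renaming (a-cut to a∈τ; b-cut to b∈τ; t-cut to x∈τ)
    open Split.Tip tip-y using () renaming
      (τ to ω; υ to υ′; S to R′; s to r; s-cut to r-cut; s≢x to r≢y; s≢a to r≢b; s≢b to r≢a;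
       s~x to r~y; s~υ to r~υ′; x-near to y-near)
    open Split.Splitting R′ using () renaming (τ-good to ω-good; a-cut to b∈ω; b-cut to a∈ω; t-cut to y∈ω)

    R : Splitting ω y
    R = record { τ-good = ω-good ; a-cut = a∈ω ; b-cut = b∈ω ; t-cut = y∈ω }

    x≢y : x ≢ y
    x≢y refl = a≁y a~x

    open Two x∈T y∈T S R

    module _ {P Q} (y∈P : τ y ≡ side P) (x∈Q : ω x ≡ side Q) where

      abstract
        -- The four vertices are `x`, `s`, `a` and `b`; being adjacent to `x`, `s` cannot lie beyond
        -- the separator of `ω`.
        four-Q : 4 ≤ # cut (side Q) + # cut cut
        four-Q = ≤-trans
          (unique-≤-count union? ((≢-sym s≢x ∷ x≢a ∷ x≢b ∷ []) ∷ (s≢a ∷ s≢b ∷ []) ∷ (a≢b ∷ []) ∷ [] ∷ [])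
            (inj₁ (x∈τ , x∈Q) ∷ s-place ∷ inj₂ (a∈τ , a∈ω) ∷ inj₂ (b∈τ , b∈ω) ∷ []))
          (count-mono-+ union? (cell? cut (side Q)) (cell? cut cut) id)
          where
          union? : Decidable (λ v → Cell cut (side Q) v ⊎ Cell cut cut v)
          union? v = cell? cut (side Q) v ⊎-dec cell? cut cut v
          x≢a : x ≢ a
          x≢a refl = clash a∈ω x∈Q
          x≢b : x ≢ b
          x≢b refl = clash b∈ω x∈Q
          s-place : Cell cut (side Q) s ⊎ Cell cut cut s
          s-place = Sum.map (s-cut ,_) (s-cut ,_) (apart ω-good x∈Q (adj-sym s~x))

        four-P : 4 ≤ # (side P) cut + # cut cut
        four-P = ≤-trans
          (unique-≤-count union? ((≢-sym r≢y ∷ y≢a ∷ y≢b ∷ []) ∷ (r≢a ∷ r≢b ∷ []) ∷ (a≢b ∷ []) ∷ [] ∷ [])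
            (inj₁ (y∈P , y∈ω) ∷ r-place ∷ inj₂ (a∈τ , a∈ω) ∷ inj₂ (b∈τ , b∈ω) ∷ []))
          (count-mono-+ union? (cell? (side P) cut) (cell? cut cut) id)
          where
          union? : Decidable (λ v → Cell (side P) cut v ⊎ Cell cut cut v)
          union? v = cell? (side P) cut v ⊎-dec cell? cut cut v
          y≢a : y ≢ a
          y≢a refl = clash a∈τ y∈P
          y≢b : y ≢ b
          y≢b refl = clash b∈τ y∈P
          r-place : Cell (side P) cut r ⊎ Cell cut cut r
          r-place = Sum.map (_, r-cut) (_, r-cut) (apart τ-good y∈P (adj-sym r~y))

        -- Side `P` of `τ` contains a second vertex `z` of T besides `y`. The corner of `z` is a
        -- single vertex with a tight boundary, and the other corner on this side misses T. The
        -- disjunction is over the side of `ω` on which `z` lies.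
        Corners : Set
        Corners = 5 ≤ boundary (not P) (not Q) ×
          ((boundary P Q ≤ 5 × # (side P) (side Q) ≤ 1) × (# (side P) (side (not Q)) ≤ 0 ⊎ 7 ≤ boundary P (not Q)) ⊎
           (boundary P (not Q) ≤ 5 × # (side P) (side (not Q)) ≤ 1) × (# (side P) (side Q) ≤ 0 ⊎ 7 ≤ boundary P Q))

        corners : Corners
        corners with other x∈T S P y
        ... | z , z∈T , z∈P , z≢y with placed y∈T R z∈T z≢y
        ...   | Q′ , z∈Q′ with place-cases Q (ω z)
        ...     | inj₂ (inj₁ c)   = clash c z∈Q′
        ...     | inj₁ z∈Q        = occupied (proj₂ (Exchange.opposite x∈T y∈T S R y∈P z∈T z∈P z≢y z∈Q))
                                , inj₁ (swap (Exchange.alone x∈T y∈T S R y∈P z∈T z∈P z≢y z∈Q) , avoiding-T P (not Q) free)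
          where
          free : ∀ {t} → T t → ¬ Cell (side P) (side (not Q)) t
          free t∈T (t∈P , t∉Q) with Exchange.on-x x∈T y∈T S R y∈P z∈T z∈P z≢y z∈Q t∈T t∈P
          ... | inj₁ refl = clash y∈ω t∉Q
          ... | inj₂ refl = opposed z∈Q t∉Q
        ...     | inj₂ (inj₂ z∉Q) = occupied (proj₂ opposite)
                                , inj₂ (swap (Exchange.alone x∈T y∈T S R y∈P z∈T z∈P z≢y z∉Q) , avoiding-T P Q free)
          where
          free : ∀ {t} → T t → ¬ Cell (side P) (side Q) t
          free t∈T (t∈P , t∈Q) with Exchange.on-x x∈T y∈T S R y∈P z∈T z∈P z≢y z∉Q t∈T t∈P
          ... | inj₁ refl = clash y∈ω t∈Q
          ... | inj₂ refl = opposed t∈Q z∉Q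
          opposite : ∃ (Cell (side (not P)) (side (not Q)))
          -- The companion of `z` on side `not Q` is not on side `P`, where T has only `y` and `z`,
          -- nor in the separator of `τ`, which meets T only in `x`, a vertex on side `Q`.
          opposite with other y∈T R (not Q) z
          ... | t , t∈T , t∉Q , t≢z with place-cases P (τ t)
          ...   | inj₂ (inj₂ t∉P) = t , t∉P , t∉Q
          ...   | inj₂ (inj₁ c) with only-t x∈T S t∈T c
          ...     | refl = opposed x∈Q t∉Q
          opposite | t , t∈T , t∉Q , t≢z | inj₁ t∈P with Exchange.on-x x∈T y∈T S R y∈P z∈T z∈P z≢y z∉Q t∈T t∈P
          ...     | inj₁ refl = clash y∈ω t∉Q
          ...     | inj₂ refl = ⊥-elim (t≢z refl)

        counts : # cut cut ≡ 3 × # cut (side Q) ≡ 1 × # (side P) cut ≡ 1 × # cut (side (not Q)) ≡ 1 ×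
                 # (side P) (side Q) + # (side P) cut + # (side P) (side (not Q)) ≤ 2
        counts = final-arith (cells P Q) (τ-cut P) (σ-cut Q)
          (some-≤-count (cell? cut (side Q)) (x∈τ , x∈Q))
          (some-≤-count (cell? (side P) cut) (y∈P , y∈ω))
          four-Q four-P (proj₁ corners) (proj₂ corners)

        s∈ω : ω s ≡ cut
        s∈ω with apart ω-good x∈Q (adj-sym s~x)
        ... | inj₂ c = c
        ... | inj₁ s∈Q = ⊥-elim (s≢x (count-≤-1 (cell? cut (side Q)) (≤-reflexive (proj₁ (proj₂ counts))) (s-cut , s∈Q) (x∈τ , x∈Q)))

        r∈τ : τ r ≡ cut
        r∈τ with apart τ-good y∈P (adj-sym r~y)
        ... | inj₂ c = c
        ... | inj₁ r∈P = ⊥-elim (r≢y (count-≤-1 (cell? (side P) cut) (≤-reflexive (proj₁ (proj₂ (proj₂ counts)))) (r∈P , r-cut) (y∈P , y∈ω)))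

        r≡s : r ≡ s
        r≡s = decidable-stable (r Fin.≟ s) λ r≢s → <⇒≱
          (unique-≤-count (cell? cut cut) ((r≢s ∷ r≢a ∷ r≢b ∷ []) ∷ (s≢a ∷ s≢b ∷ []) ∷ (a≢b ∷ []) ∷ [] ∷ [])
            ((r∈τ , r-cut) ∷ (s-cut , s∈ω) ∷ (a∈τ , a∈ω) ∷ (b∈τ , b∈ω) ∷ []))
          (≤-reflexive (proj₁ counts))

        last : ∃ (Cell cut (side (not Q)))
        last = witness (cell? cut (side (not Q))) (≤-reflexive (sym (proj₁ (proj₂ (proj₂ (proj₂ counts))))))

      -- The candidates for neighbours of `y`: at most one further vertex on side `P`, and four in
      -- the separator, as `y` is not adjacent to `a`. These are at most five, so `y` is joined to
      -- all of them.
      W : Pred V 0ℓ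
      W v = (τ v ≡ side P × v ≢ y) ⊎ (τ v ≡ cut × v ≢ a)

      w? : Decidable W
      w? v = (at τ (side P) without y) v ⊎-dec (at τ cut without a) v

      abstract
        W≤5 : count w? ≤ 5
        W≤5 = ≤-trans (count-mono-+ w? (at τ (side P) without y) (at τ cut without a) id)
          (+-mono-≤ {_} {1} {_} {4}
            (≤-pred (≤-trans (without-count (at τ (side P)) y∈P)
              (subst (_≤ 2) (row (side P) Q) (proj₂ (proj₂ (proj₂ (proj₂ counts)))))))
            (≤-pred (≤-trans (without-count (at τ cut) a∈τ) (≤-reflexive (τ-good .size-cut)))))

        N⊆W : ∀ {v} → Adj y v → W v
        N⊆W yv with apart τ-good y∈P yv
        ... | inj₁ v∈P = inj₁ (v∈P , λ v≡y → adj⇒≢ yv (sym v≡y))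
        ... | inj₂ v∈τ = inj₂ (v∈τ , λ { refl → a≁y (adj-sym yv) })

      -- The separator of `τ` consists of `x`, `s`, `a`, `b` and `v`. As a neighbour of `y`, `v` is
      -- in the separator of `υ′` and so adjacent to `r`, which is `s`. Hence it is in the separator
      -- of `υ` as well, but that one meets the separator of `τ` only in `a`.
      absurd : ∀ {v} → Cell cut (side (not Q)) v → ⊥
      absurd {v} (v∈τ , v∉Q) with y-near (five-neighbours w? y N⊆W W≤5 (inj₂ (v∈τ , λ { refl → clash a∈ω v∉Q })))
      ... | inj₁ refl = clash r-cut v∉Q
      ... | inj₂ v∈υ′ with s-near (subst (λ w → Adj w v) r≡s (r~υ′ v∈υ′ λ { refl → clash b∈ω v∉Q }))
      ...   | inj₁ refl = opposed x∈Q v∉Q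
      ...   | inj₂ v∈υ with υ∩τ v∈υ v∈τ
      ...     | refl = clash a∈ω v∉Q

    impossible : ⊥
    impossible with placed x∈T S y∈T (≢-sym x≢y) | placed y∈T R x∈T x≢y
    ... | P , y∈P | Q , x∈Q with last y∈P x∈Q
    ...   | v , v∈ = absurd y∈P x∈Q v∈

  -- Descent to a contradiction

  no-two-fragment : ∀ {σ p a b} → ¬ TwoFragment σ p a b
  -- The refuted universal statements yield no explicit `υ` and `υ′`; since the goal is absurd,
  -- decidability of the two memberships suffices.
  no-two-fragment {a = a} {b} F = Split.separator-halving F λ {υ} gυ a∈υ →
    decidable-stable (at υ cut b) λ b∉υ → Split.separator-halving (swapped F) λ {υ′} gυ′ b∈υ′ →
    decidable-stable (at υ′ cut a) λ a∉υ′ → ends gυ a∈υ b∉υ gυ′ b∈υ′ a∉υ′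
    where
    ends : ∀ {υ υ′} → Good υ → υ a ≡ cut → υ b ≢ cut → Good υ′ → υ′ b ≡ cut → υ′ a ≢ cut → ⊥
    ends {υ} {υ′} gυ a∈υ b∉υ gυ′ b∈υ′ a∉υ′ with cut-or-side (υ b) | cut-or-side (υ′ a)
    ... | inj₁ c | _ = b∉υ c
    ... | inj₂ _ | inj₁ c = a∉υ′ c
    ... | inj₂ (_ , b∈q) | inj₂ (_ , a∈q) with Split.tip F gυ a∈υ b∈q | Split.tip (swapped F) gυ′ b∈υ′ a∈q
    ...   | x , X , tip-x | y , Y , tip-y = Endgame.impossible F X Y tip-x tip-y

  -- Strong induction on the size of a side replaces the choice of a smallest one: the induction
  -- hypothesis is the minimality that `LargeFragment` asks for.
  no-good : ∀ {σ} → ¬ Good σ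
  no-good {σ} gσ = <-rec (λ m → ∀ {σ} → Good σ → ∀ p → size σ (side p) ≡ m → ⊥) descend _ gσ true refl
    where
    descend : ∀ m → (∀ {k} → k < m → ∀ {σ} → Good σ → ∀ p → size σ (side p) ≡ k → ⊥) →
           ∀ {σ} → Good σ → ∀ p → size σ (side p) ≡ m → ⊥
    descend m smaller {σ} gσ p refl with 3 ≤? size σ (side p)
    ... | yes 3≤ = LargeFragment.impossible gσ p
      (λ {τ} gτ q → ≮⇒≥ λ lt → smaller lt gτ q refl) 3≤
    ... | no 3≰ with witness₂ (at σ (side p)) (gσ .size-side p)
    ...   | a , b , a∈ , b∈ , b≢a = no-two-fragment record
      { good = gσ ; a∈ = a∈ ; b∈ = b∈ ; a≢b = ≢-sym b≢a
      ; only = λ v∈ → count-≤-2 (at σ (side p)) (≤-pred (≰⇒> 3≰)) a∈ b∈ v∈ (≢-sym b≢a) }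

-- Subsets as decidable predicates

⌊_⌋ : ∀ {n} {P : Pred (Fin n) 0ℓ} → Decidable P → Subset n
⌊ P? ⌋ = tabulate (does ∘ P?)

∈⌊⌋⁻ : ∀ {n} {P : Pred (Fin n) 0ℓ} (P? : Decidable P) {v} → v ∈ ⌊ P? ⌋ → P v
∈⌊⌋⁻ P? {v} v∈ with P? v | trans (sym (lookup∘tabulate (does ∘ P?) v)) ([]=⇒lookup v∈)
... | yes p | _ = p

∈⌊⌋⁺ : ∀ {n} {P : Pred (Fin n) 0ℓ} (P? : Decidable P) {v} → P v → v ∈ ⌊ P? ⌋
∈⌊⌋⁺ P? {v} p = lookup⇒[]= v _ (trans (lookup∘tabulate (does ∘ P?) v) (dec-true (P? v) p))

count-∈ : ∀ {n} (T : Subset n) → count (_∈? T) ≡ ∣ T ∣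
count-∈ []            = refl
count-∈ (inside ∷ T)  = cong suc (trans (≤-antisym
  (count-mono (λ v → suc v ∈? inside ∷ T) (_∈? T) drop-there)
  (count-mono (_∈? T) (λ v → suc v ∈? inside ∷ T) there)) (count-∈ T))
count-∈ (outside ∷ T) = trans (≤-antisym
  (count-mono (λ v → suc v ∈? outside ∷ T) (_∈? T) drop-there)
  (count-mono (_∈? T) (λ v → suc v ∈? outside ∷ T) there)) (count-∈ T)

∣⌊⌋∣ : ∀ {n} {P : Pred (Fin n) 0ℓ} (P? : Decidable P) → ∣ ⌊ P? ⌋ ∣ ≡ count P?
∣⌊⌋∣ P? = trans (sym (count-∈ ⌊ P? ⌋)) (≤-antisym
  (count-mono (_∈? ⌊ P? ⌋) P? (∈⌊⌋⁻ P?)) (count-mono P? (_∈? ⌊ P? ⌋) (∈⌊⌋⁺ P?)))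

-- A decidable 5-connected spanning subgraph

module Walks {n} (G : Graph n) where

  start : ∀ {S x z} → Reach G S x z → x ∈ S
  start (here x∈)     = x∈
  start (step x∈ _ _) = x∈

  edges : ∀ {S x z} → Reach G S x z → List (Fin n × Fin n)
  edges (here _)                 = []
  edges (step {x} {y} _ _ walk)  = (x , y) ∷ edges walk

  edges-adjacent : ∀ {S x z} (walk : Reach G S x z) {u v} → (u , v) List.∈ edges walk → Adj G u v
  edges-adjacent (step _ a walk) (here refl) = a
  edges-adjacent (step _ a walk) (there e)   = edges-adjacent walk e

  propagate : ∀ {S x z} (walk : Reach G S x z) {X : Pred (Fin n) 0ℓ} →
              (∀ {u v} → (u , v) List.∈ edges walk → u ∈ S → v ∈ S → X u → X v) → X x → X z
  propagate (here _)         next Xx = Xx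
  propagate (step x∈ a walk) next Xx =
    propagate walk (next ∘ there) (next (here refl) x∈ (start walk) Xx)

-- The edges of one walk for every separation task form a decidable spanning subgraph that is
-- still 5-connected.
module Skeleton {n} (G : Graph n) (connected : G IsConnected 5) where
  open Walks G
  open DecMembership (≡-dec (Fin._≟_ {n}) (Fin._≟_ {n})) using () renaming (_∈?_ to _∈ˡ?_)

  Task : Subset n → Fin n → Fin n → Set
  Task T x y = ∣ T ∣ < 5 × x ∉ T × y ∉ T

  task? : ∀ T x y → Dec (Task T x y)
  task? T x y = ∣ T ∣ <? 5 ×-dec ¬? (x ∈? T) ×-dec ¬? (y ∈? T)

  solution : ∀ {T x y} → Task T x y → Reach G (∁ T) x y
  solution {T} {x} {y} (small , x∉ , y∉) = proj₂ (proj₂ connected T small) x y x∉ y∉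

  -- There are finitely many tasks, each contributing one finite list, so membership is decidable
  -- although `Adj` is not. Triples that are no task contribute nothing.
  used : ∀ T x y → List (Fin n × Fin n)
  used T x y with task? T x y
  ... | yes task = edges (solution task)
  ... | no _     = []

  Used : Fin n → Fin n → Set
  Used u v = ∃ λ T → ∃₂ λ x y → (u , v) List.∈ used T x y

  used? : ∀ u v → Dec (Used u v)
  used? u v = anySubset? λ T → Fin.any? λ x → Fin.any? λ y → (u , v) ∈ˡ? used T x y

  Edge : Fin n → Fin n → Set
  Edge u v = Used u v ⊎ Used v u

  edge? : ∀ u v → Dec (Edge u v)
  edge? u v = used? u v ⊎-dec used? v u

  edge-sym : ∀ {u v} → Edge u v → Edge v u
  edge-sym = Sum.swap

  used-adjacent : ∀ {u v} → Used u v → Adj G u v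
  used-adjacent (T , x , y , e) with task? T x y
  ... | yes task = edges-adjacent (solution task) e

  edge-adjacent : ∀ {u v} → Edge u v → Adj G u v
  edge-adjacent = [ used-adjacent , Graph.sym G ∘ used-adjacent ]′

  edge-irrefl : ∀ {u} → ¬ Edge u u
  edge-irrefl = Graph.irrefl G ∘ edge-adjacent

  used-walk : ∀ {T x y} → Task T x y → ∃ λ (walk : Reach G (∁ T) x y) → ∀ {u v} → (u , v) List.∈ edges walk → Edge u v
  used-walk {T} {x} {y} task = proj₁ found , λ e → inj₁ (T , x , y , subst (_ List.∈_) (sym (proj₂ found)) e)
    where
    found : ∃ λ (walk : Reach G (∁ T) x y) → used T x y ≡ edges walk
    found with task? T x y
    ... | yes task′ = solution task′ , refl
    ... | no ¬task  = ⊥-elim (¬task task)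

  -- If `R` had fewer than five vertices, the chosen walk from `u` to `v` would avoid it; its edges
  -- belong to the subgraph, so `X` would spread along it to `v`.
  five-connected : FiveConnected Edge
  five-connected {X} {R} X? R? closed (u , Xu , ¬Ru) (v , ¬Xv , ¬Rv) = ≮⇒≥ λ small →
    let walk , walk-edges = used-walk (subst (_< 5) (sym (∣⌊⌋∣ R?)) small , ¬Ru ∘ ∈⌊⌋⁻ R? , ¬Rv ∘ ∈⌊⌋⁻ R?)
    in ¬Xv (propagate walk (λ e a∈ b∈ Xa → [ id , (λ Rb → ⊥-elim (avoids b∈ Rb)) ]′ (closed Xa (avoids a∈) (walk-edges e))) Xu)
    where
    avoids : ∀ {w} → w ∈ ∁ ⌊ R? ⌋ → ¬ R w
    avoids w∈ Rw = x∈∁p⇒x∉p w∈ (∈⌊⌋⁺ R? Rw)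

-- Contracting an edge

module Contract {n} (G : Graph (suc n)) (connected : G IsConnected 5) (x y : Fin (suc n)) (x≢y : x ≢ y) where

  G′ : Graph n
  G′ = contract G x y x≢y

  merge : Fin (suc n) → Fin n
  merge v with y Fin.≟ v
  ... | yes _  = punchOut (x≢y ∘ sym)
  ... | no y≢v = punchOut y≢v

  merge-y : merge y ≡ merge x
  merge-y with y Fin.≟ y | y Fin.≟ x
  ... | no y≢y | _      = ⊥-elim (y≢y refl)
  ... | _      | yes e  = ⊥-elim (x≢y (sym e))
  ... | yes _  | no y≢x = Fin.punchOut-cong y refl

  punchIn-merge : ∀ {v} → y ≢ v → punchIn y (merge v) ≡ v
  punchIn-merge {v} y≢v with y Fin.≟ v
  ... | yes e = ⊥-elim (y≢v e)
  ... | no _  = Fin.punchIn-punchOut _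

  merge-punchIn : ∀ u → merge (punchIn y u) ≡ u
  merge-punchIn u = Fin.punchIn-injective y _ _ (punchIn-merge (Fin.punchInᵢ≢i y u ∘ sym))

  merge-adjacent : ∀ {u v} → Adj G u v → merge u ≢ merge v → Adj G′ (merge u) (merge v)
  merge-adjacent {u} {v} uv ne with y Fin.≟ u | y Fin.≟ v
  ... | yes refl | yes refl = ⊥-elim (ne refl)
  ... | yes refl | no y≢v   = ne , inj₂ (inj₁ (Fin.punchIn-punchOut _ , subst (Adj G y) (sym (Fin.punchIn-punchOut y≢v)) uv))
  ... | no y≢u   | yes refl = ne , inj₂ (inj₂ (Fin.punchIn-punchOut _ , subst (λ w → Adj G w y) (sym (Fin.punchIn-punchOut y≢u)) uv))
  ... | no y≢u   | no y≢v   = ne , inj₁ (subst₂ (Adj G) (sym (Fin.punchIn-punchOut y≢u)) (sym (Fin.punchIn-punchOut y≢v)) uv)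

  pull? : (T : Subset n) → Decidable (λ v → merge v ∈ T)
  pull? T v = merge v ∈? T

  -- Each vertex of `G′` has one preimage under `merge`, except for the merged vertex, which has
  -- two.
  count-pull : ∀ T → count (pull? T) ≡ indicator (does (merge y ∈? T)) + ∣ T ∣
  count-pull T = trans (count-punchIn (pull? T) y) (cong (indicator (does (merge y ∈? T)) +_) (trans (≤-antisym
    (count-mono (pull? T ∘ punchIn y) (_∈? T) (λ {v} → subst (_∈ T) (merge-punchIn v)))
    (count-mono (_∈? T) (pull? T ∘ punchIn y) (λ {v} → subst (_∈ T) (sym (merge-punchIn v))))) (count-∈ T)))

  count-pull-≤ : ∀ T → count (pull? T) ≤ suc ∣ T ∣
  count-pull-≤ T = subst (_≤ suc ∣ T ∣) (sym (count-pull T)) (+-monoˡ-≤ ∣ T ∣ (indicator-≤ (does (merge y ∈? T))))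
    where
    indicator-≤ : ∀ b → indicator b ≤ 1
    indicator-≤ true  = ≤-refl
    indicator-≤ false = z≤n

  ∣∣-≤-pull : ∀ T → ∣ T ∣ ≤ count (pull? T)
  ∣∣-≤-pull T = subst (∣ T ∣ ≤_) (sym (count-pull T)) (m≤n+m ∣ T ∣ _)

  merge-walk : ∀ {T u v} → Reach G (∁ ⌊ pull? T ⌋) u v → Reach G′ (∁ T) (merge u) (merge v)
  merge-walk {T} = go
    where
    avoids : ∀ {w} → w ∈ ∁ ⌊ pull? T ⌋ → merge w ∈ ∁ T
    avoids w∈ = x∉p⇒x∈∁p (x∈∁p⇒x∉p w∈ ∘ ∈⌊⌋⁺ (pull? T))
    go : ∀ {u v} → Reach G (∁ ⌊ pull? T ⌋) u v → Reach G′ (∁ T) (merge u) (merge v)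
    go (here u∈) = here (avoids u∈)
    go (step {u} {w} u∈ a walk) with merge u Fin.≟ merge w
    -- A step between the two merged vertices disappears.
    ... | yes e = subst (λ t → Reach G′ (∁ T) t _) (sym e) (go walk)
    ... | no ne = step (avoids u∈) (merge-adjacent a ne) (go walk)

  -- Pulling back adds at most one vertex to a set, so fewer than four become fewer than five, and
  -- walks of `G` avoiding the preimage project to `G′`.
  four-connected : G′ IsConnected 4
  four-connected = ≤-pred (proj₁ connected) , λ T small →
    let exists , joined = proj₂ connected ⌊ pull? T ⌋ (subst (_< 5) (sym (∣⌊⌋∣ (pull? T))) (s≤s (≤-trans (count-pull-≤ T) small)))
        v , v∉ = exists
    in (merge v , v∉ ∘ ∈⌊⌋⁺ (pull? T)) ,
       λ u w u∉ w∉ → subst₂ (Reach G′ (∁ T)) (merge-punchIn u) (merge-punchIn w)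
         (merge-walk (joined (punchIn y u) (punchIn y w)
           (u∉ ∘ subst (_∈ T) (merge-punchIn u) ∘ ∈⌊⌋⁻ (pull? T))
           (w∉ ∘ subst (_∈ T) (merge-punchIn w) ∘ ∈⌊⌋⁻ (pull? T))))

-- Existence of a contractible edge

module Existence {n} (G : Graph (suc n)) (connected : G IsConnected 5) where
  open Skeleton G connected
  open Separations Edge edge? edge-sym edge-irrefl (proj₁ connected) five-connected

  good? : ∀ σ → Dec (Good σ)
  good? σ = map′
    (λ (c , t , f , s) → record { size-cut = c ; size-side = λ { true → t ; false → f } ; separated = s })
    (λ g → Good.size-cut g , Good.size-side g true , Good.size-side g false , Good.separated g)
    (size σ cut ≟ 5 ×-dec 2 ≤? size σ (side true) ×-dec 2 ≤? size σ (side false) ×-dec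
     Fin.all? λ u → Fin.all? λ v → separated? u v)
    where
    separated? : ∀ u v → Dec (σ u ≡ side true → σ v ≡ side false → ¬ Edge u v)
    separated? u v = (σ u ≟ᵖ side true) →-dec (σ v ≟ᵖ side false) →-dec ¬? (edge? u v)

  -- Coding separations by two subsets lets `separated?` search through them.
  placement : Subset (suc n) → Subset (suc n) → Fin (suc n) → Place
  placement T A = Region.region (_∈? A) (_∈? T)

  Separated : Fin (suc n) → Fin (suc n) → Set
  Separated x y = ∃₂ λ T A → Good (placement T A) × placement T A x ≡ cut × placement T A y ≡ cut

  separated? : ∀ x y → Dec (Separated x y)
  separated? x y = anySubset? λ T → anySubset? λ A →
    good? (placement T A) ×-dec (placement T A x ≟ᵖ cut) ×-dec (placement T A y ≟ᵖ cut)

  module _ (x y : Fin (suc n)) (x≢y : x ≢ y) (inseparable : ¬ Separated x y) where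
    open Contract G connected x y x≢y

    no-nontrivial-cut : ¬ NontrivialCut G′ 4
    no-nontrivial-cut (T , ∣T∣≡4 , A , B , cover , T∩A , T∩B , A∩B , no-edge , 2≤A , 2≤B) =
      inseparable (⌊ pull? T ⌋ , ⌊ pull? A ⌋ , separation , in-cut merge-x∈ , in-cut merge-y∈)
      where
      X? = _∈? ⌊ pull? A ⌋
      R? = _∈? ⌊ pull? T ⌋
      open Region X? R?

      to-A : ∀ {v} → merge v ∈ A → v ∈ ⌊ pull? A ⌋
      to-A = ∈⌊⌋⁺ (pull? A)

      to-T : ∀ {v} → merge v ∈ T → v ∈ ⌊ pull? T ⌋
      to-T = ∈⌊⌋⁺ (pull? T)

      from-A : ∀ {v} → v ∈ ⌊ pull? A ⌋ → merge v ∈ A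
      from-A = ∈⌊⌋⁻ (pull? A)

      from-T : ∀ {v} → v ∈ ⌊ pull? T ⌋ → merge v ∈ T
      from-T = ∈⌊⌋⁻ (pull? T)

      closed : ∀ {u v} → u ∈ ⌊ pull? A ⌋ → u ∉ ⌊ pull? T ⌋ → Edge u v → v ∈ ⌊ pull? A ⌋ ⊎ v ∈ ⌊ pull? T ⌋
      closed {u} {v} u∈A _ uv with merge v ∈? T
      ... | yes v∈T = inj₂ (to-T v∈T)
      ... | no v∉T with cover (merge v) v∉T
      ...   | inj₁ v∈A = inj₁ (to-A v∈A)
      ...   | inj₂ v∈B = ⊥-elim (no-edge _ _ (from-A u∈A) v∈B (merge-adjacent (edge-adjacent uv)
                (λ e → A∩B _ (from-A u∈A) (subst (_∈ B) (sym e) v∈B))))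

      count-R : count R? ≡ count (pull? T)
      count-R = ≤-antisym (count-mono R? (pull? T) from-T) (count-mono (pull? T) R? to-T)

      separation : Good region
      separation = region-good
        (subst (_≤ 5) (sym count-R) (≤-trans (count-pull-≤ T) (≤-reflexive (cong suc ∣T∣≡4))))
        (≤-trans 2≤A (≤-trans (∣∣-≤-pull A)
          (count-mono (pull? A) (λ v → X? v ×-dec ¬? (R? v)) (λ v∈A → to-A v∈A , λ v∈T → T∩A _ (from-T v∈T) v∈A))))
        (≤-trans 2≤B (≤-trans (∣∣-≤-pull B)
          (count-mono (pull? B) (λ v → ¬? (X? v) ×-dec ¬? (R? v))
            (λ v∈B → (λ v∈A → A∩B _ (from-A v∈A) v∈B) , λ v∈T → T∩B _ (from-T v∈T) v∈B))))
        closed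

      -- Otherwise the four vertices of T would already separate the 5-connected graph.
      merge-y∈ : merge y ∈ T
      merge-y∈ with merge y ∈? T | count-pull T
      ... | yes y∈ | _ = y∈
      ... | no _   | count≡∣T∣ = ⊥-elim (<⇒≱ (≤-trans (≤-reflexive (sym (Good.size-cut separation)))
        (count-mono (at region cut) (pull? T) (from-T ∘ region-cut⁻))) (≤-reflexive (trans count≡∣T∣ ∣T∣≡4)))

      merge-x∈ : merge x ∈ T
      merge-x∈ = subst (_∈ T) merge-y merge-y∈

      in-cut : ∀ {v} → merge v ∈ T → region v ≡ cut
      in-cut = region-cut ∘ to-T

    contractible : QuasiConnected G′ 5
    contractible = four-connected , no-nontrivial-cut

  InseparableEdge : Set
  InseparableEdge = ∃₂ λ x y → Edge x y × ¬ Separated x y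

  all-separated : ¬ InseparableEdge → ∀ {x y} → Edge x y → ∃ λ σ → Good σ × σ x ≡ cut × σ y ≡ cut
  all-separated none {x} {y} e =
    let T , A , good = decidable-stable (separated? x y) λ inseparable → none (x , y , e , inseparable)
    in placement T A , good

  abstract
    inseparable-edge : InseparableEdge
    inseparable-edge = decidable-stable (Fin.any? λ x → Fin.any? λ y → edge? x y ×-dec ¬? (separated? x y)) λ none →
      -- Any edge would do: its separator belongs to a good separation, and `no-good` excludes
      -- these.
      let y , e = witness (edge? zero) (≤-trans (s≤s z≤n) (degree zero))
      in EveryEdgeSeparated.no-good Edge edge? edge-sym edge-irrefl (proj₁ connected) five-connected
           (all-separated none) (proj₁ (proj₂ (all-separated none e)))

  contractible-edge : InseparableEdge → ∃₂ λ x y → Σ (Adj G x y) λ e → QuasiConnected (G / (x , y , e)) 5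
  contractible-edge (x , y , e , inseparable) = x , y , edge-adjacent e , contractible x y _ inseparable

theorem1 : ∀ {n} (G : Graph (suc n)) → G IsConnected 5 →
    Σ (Fin (suc n)) λ x → Σ (Fin (suc n)) λ y → Σ (Adj G x y) λ e →
    QuasiConnected (G / (x , y , e)) 5
theorem1 G connected = Existence.contractible-edge G connected (Existence.inseparable-edge G connected)
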